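{- Every finite transitive permutation group of prime power degree has the EKR property; that is, if $G\leqslant\mathrm{Sym}(\Omega)$ is transitive with $|\Omega|=p^k$ for a prime $p$ and integer $k\ge0$, then every intersecting set $S\subseteq G$ satisfies $|S|\leqslant|G_\omega|$ for $\omega\in\Omega$.
   Context: For a finite permutation group $G\leqslant\mathrm{Sym}(\Omega)$, elements $x,y\in G$ intersect if some $\alpha\in\Omega$ satisfies $\alpha^{xy^{ -1}}=\alpha$; a subset $S\subseteq G$ is an intersecting set if every two of its elements intersect. $G$ has the EKR property if its point stabilizers are intersecting sets of maximum possible size. -}

module Defs where

open import Data.Nat using (ℕ)
open import Data.Fin using (Fin)
open import Data.Fin.Properties using (_≟_)
open import Data.Fin.Permutation using (Permutation′; _⟨$⟩ʳ_; _∘ₚ_; flip; id; _≈_)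
open import Data.List using (List; length; filter)
open import Data.List.Membership.Propositional using (_∈_)
open import Data.List.Relation.Unary.AllPairs using (AllPairs)
open import Data.Product using (Σ; ∃; _×_)
open import Relation.Binary.PropositionalEquality using (_≡_)
open import Relation.Nullary using (¬_)

-- Permutations of Ω = Fin n act on the right: α^{xy} = y (x α),
-- matching stdlib's  x ∘ₚ y  (apply x first, then y).
-- Two permutations are equal iff they agree pointwise (_≈_).

-- A list of permutations with no two (pointwise-)equal entries:
-- a finite set of permutations, with cardinality given by its length.
DistinctPerms : ∀ {n} → List (Permutation′ n) → Set
DistinctPerms = AllPairs (λ x y → ¬ (x ≈ y))

_∈ₚ_ : ∀ {n} → Permutation′ n → List (Permutation′ n) → Set
x ∈ₚ G = Σ _ λ g → (g ∈ G) × (x ≈ g)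

record IsPermGroup {n : ℕ} (G : List (Permutation′ n)) : Set where
  field
    distinct : DistinctPerms G
    has-id   : id ∈ₚ G
    closed-∘ : ∀ {x y} → x ∈ G → y ∈ G → (x ∘ₚ y) ∈ₚ G
    closed-⁻¹ : ∀ {x} → x ∈ G → flip x ∈ₚ G

IsTransitive : ∀ {n} → List (Permutation′ n) → Set
IsTransitive {n} G = ∀ (α β : Fin n) → Σ _ λ g → (g ∈ G) × (g ⟨$⟩ʳ α ≡ β)

Intersect : ∀ {n} → Permutation′ n → Permutation′ n → Set
Intersect {n} x y = ∃ λ (α : Fin n) → (x ∘ₚ flip y) ⟨$⟩ʳ α ≡ α

record IsIntersectingSet {n : ℕ} (G S : List (Permutation′ n)) : Set where
  field
    distinct  : DistinctPerms S
    subset    : ∀ {x} → x ∈ S → x ∈ₚ G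
    intersect : ∀ {x y} → x ∈ S → y ∈ S → Intersect x y

stabilizerSize : ∀ {n} → List (Permutation′ n) → Fin n → ℕ
stabilizerSize G ω = length (filter (λ g → g ⟨$⟩ʳ ω ≟ ω) G)

{-# OPTIONS --safe #-}
-- A Sylow p-subgroup P of G is already transitive on the pᵏ points. A transitive p-group contains a
-- sharply transitive subset T: for M normal in P, let Z/M be the centre of P/M; if T is sharply transitive
-- on the Z-orbits, then {s t | t ∈ T}, with s running over representatives of Z modulo the elements of Z
-- that fix the M-orbits, is sharply transitive on the M-orbits. Descending along the upper central series
-- from M = P to M = 1 gives T. Finally (s , t) ↦ t⁻¹ s is injective on S × T for an intersecting set S,
-- so |S| pᵏ ≤ |G| = pᵏ |G_ω|.
module Submission where

open import Defs
open import Data.Nat hiding (_≟_)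
open import Data.Nat.Properties hiding (_≟_)
open import Data.Nat.DivMod using (_%_; _/_; m≡m%n+[m/n]*n; m%n<n)
open import Data.Nat.Divisibility
  using (_∣_; _∣?_; divides; ∣m+n∣m⇒∣n; n∣m*n; m∣m*n; ∣m⇒∣m*n; ∣-trans; ∣⇒≤; *-cancelˡ-∣; *-monoʳ-∣)
open import Data.Nat.GeneralisedArithmetic using (fold; fold-+)
open import Data.Nat.Induction using (<-wellFounded; Acc; acc)
open import Data.Nat.Primality using (Prime; prime⇒nonZero; prime⇒nonTrivial; euclidsLemma)
open import Data.Nat.Coprimality using (Coprime; prime⇒coprime; coprime-Bézout)
open import Data.Nat.GCD using (module Bézout)
open import Data.Fin using (Fin; zero; suc; toℕ; fromℕ<)
open import Data.Fin.Permutation as Perm using (Permutation′; _⟨$⟩ʳ_; _⟨$⟩ˡ_; flip)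
open import Data.Fin.Properties using (_≟_; any?; all?; pigeonhole; toℕ-fromℕ<; nonZeroIndex)
open import Data.List
  using (List; []; _∷_; [_]; _++_; length; lookup; map; filter; foldr; replicate; applyUpTo; allFin;
         deduplicate; cartesianProduct; cartesianProductWith)
open import Data.List.Properties
  using (length-++; length-map; length-applyUpTo; length-tabulate; length-filter; length-replicate;
         filter-reject; filter-≐; filter-all; ≡-dec; ∷-injective; ∷-injectiveˡ; ∷-injectiveʳ; ++-assoc;
         ++-identityʳ)
open import Data.List.Membership.Propositional using (_∈_; _∉_)
open import Data.List.Membership.Propositional.Properties
  using (∈-∃++; ∈-++⁺ˡ; ∈-++⁺ʳ; ∈-++⁻; ∈-map⁺; ∈-map⁻; ∈-filter⁺; ∈-filter⁻; ∈-allFin; ∈-lookup;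
         ∈-applyUpTo⁺; ∈-applyUpTo⁻; ∈-deduplicate⁺; ∈-deduplicate⁻; ∈-cartesianProduct⁻;
         ∈-cartesianProductWith⁺; ∈-cartesianProductWith⁻)
open import Data.List.Relation.Unary.All as All using (All; []; _∷_)
open import Data.List.Relation.Unary.AllPairs using ([]; _∷_)
open import Data.List.Relation.Unary.Any using (here; there; index)
open import Data.List.Relation.Unary.Any.Properties using (lookup-index)
open import Data.List.Relation.Unary.Unique.Propositional using (Unique)
open import Data.Product using (∃; Σ; _×_; _,_; proj₁; proj₂)
open import Data.Sum using (inj₁; inj₂)
open import Function using (_∘_; id)
open import Level using (0ℓ)
open import Relation.Binary using (DecidableEquality)
open import Relation.Nullary using (¬_; Dec; yes; no; ¬?; contradiction; map′; _×-dec_; _→-dec_)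
open import Relation.Unary using (Pred; Decidable)
open import Relation.Unary.Properties using (U?)
open import Algebra.Bundles using (Group)
open import Algebra.Core using (Op₁; Op₂)
open import Algebra.Structures using (IsGroup)
import Data.List.Membership.DecPropositional as DecMembership
import Data.List.Relation.Unary.All.Properties as All
import Data.List.Relation.Unary.Unique.Propositional.Properties as Unique
import Data.List.Relation.Unary.Unique.DecPropositional.Properties as DecUnique
open import Relation.Binary.PropositionalEquality hiding ([_])
import Algebra.Properties.Group

-- Counting in lists

-- A regular subgroup would give the bound at once, but a transitive p-group need not contain one;
-- hence only a subset `T` is asked for, whose distinct elements agree at no point. The centre
-- enters because `P` is transitive: an element central modulo `M` that maps one `M`-orbit to itself
-- maps all of them to themselves. So `Z`, modulo such elements, acts freely on the `M`-orbits, and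
-- one choice of representatives is sharply transitive inside every `Z`-orbit at the same time. The
-- prime power degree is what makes the Sylow subgroup transitive: an orbit of a subgroup of index
-- prime to `p` has length divisible by all of `pᵏ`. Cauchy's theorem, the growth of normalisers and
-- the nontrivial centre all rest on one count: a permutation of prime period `p` has, modulo `p`,
-- as many fixed points as points. Cosets are handled through canonical representatives, and the
-- group through positions in its list, so that equality is propositional and decidable throughout.

private variable A B C : Set

length-≤-injection : (f : A → B) {xs : List A} {ys : List B} → Unique xs →
  (∀ {x y} → x ∈ xs → y ∈ xs → f x ≡ f y → x ≡ y) →
  (∀ {x} → x ∈ xs → f x ∈ ys) → length xs ≤ length ys
length-≤-injection f {[]} _ _ _ = z≤n
length-≤-injection f {x ∷ xs} (x∉xs ∷ uniq) inj into with ∈-∃++ (into (here refl))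
... | us , vs , refl = begin
  suc (length xs)             ≤⟨ s≤s (length-≤-injection f uniq (λ p q → inj (there p) (there q)) into′) ⟩
  suc (length (us ++ vs))     ≡⟨ cong suc (length-++ us) ⟩
  suc (length us + length vs) ≡⟨ +-suc (length us) (length vs) ⟨
  length us + suc (length vs) ≡⟨ length-++ us ⟨
  length (us ++ f x ∷ vs)     ∎
  where
  open ≤-Reasoning
  into′ : ∀ {y} → y ∈ xs → f y ∈ us ++ vs
  into′ y∈xs with ∈-++⁻ us (into (there y∈xs))
  ... | inj₁ y∈us = ∈-++⁺ˡ y∈us
  ... | inj₂ (there y∈vs) = ∈-++⁺ʳ us y∈vs
  ... | inj₂ (here fy≡fx) =
    contradiction (inj (here refl) (there y∈xs) (sym fy≡fx)) (All.lookup x∉xs y∈xs)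

length-≤-⊆ : {xs ys : List A} → Unique xs → (∀ {x} → x ∈ xs → x ∈ ys) → length xs ≤ length ys
length-≤-⊆ uniq = length-≤-injection id uniq (λ _ _ → id)

module _ {P : Pred A 0ℓ} (P? : Decidable P) where

  length-filter-¬ : ∀ xs → length xs ≡ length (filter P? xs) + length (filter (¬? ∘ P?) xs)
  length-filter-¬ [] = refl
  length-filter-¬ (x ∷ xs) with P? x
  ... | yes _ = cong suc (length-filter-¬ xs)
  ... | no  _ = trans (cong suc (length-filter-¬ xs)) (sym (+-suc _ _))

  filter-filter : {Q : Pred A 0ℓ} (Q? : Decidable Q) → (∀ {x} → Q x → P x) →
    ∀ xs → filter Q? (filter P? xs) ≡ filter Q? xs
  filter-filter Q? Q⇒P [] = refl
  filter-filter Q? Q⇒P (x ∷ xs) with P? x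
  ... | no ¬p = trans (filter-filter Q? Q⇒P xs) (sym (filter-reject Q? (¬p ∘ Q⇒P)))
  ... | yes _ with Q? x
  ...   | yes _ = cong (x ∷_) (filter-filter Q? Q⇒P xs)
  ...   | no  _ = filter-filter Q? Q⇒P xs

length-fibres : (_≟_ : DecidableEquality B) (f : A → B) (c : ℕ) (xs : List A) {ys : List B} →
  Unique ys → (∀ {x} → x ∈ xs → f x ∈ ys) →
  (∀ {y} → y ∈ ys → length (filter (λ x → f x ≟ y) xs) ≡ c) → length xs ≡ length ys * c
length-fibres _≟_ f c [] {[]} _ _ _ = refl
length-fibres _≟_ f c (x ∷ xs) {[]} _ into _ = contradiction (into (here refl)) λ ()
length-fibres _≟_ f c xs {y ∷ ys} (y∉ys ∷ uniq) into size = begin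
  length xs                                          ≡⟨ length-filter-¬ (λ x → f x ≟ y) xs ⟩
  length (filter (λ x → f x ≟ y) xs) + length rest   ≡⟨ cong₂ _+_ (size (here refl)) (length-fibres _≟_ f c rest uniq into′ size′) ⟩
  c + length ys * c                                  ∎
  where
  open ≡-Reasoning
  rest = filter (λ x → ¬? (f x ≟ y)) xs
  into′ : ∀ {x} → x ∈ rest → f x ∈ ys
  into′ x∈rest with ∈-filter⁻ (λ x → ¬? (f x ≟ y)) {xs = xs} x∈rest
  ... | x∈xs , fx≢y with into x∈xs
  ...   | here fx≡y = contradiction fx≡y fx≢y
  ...   | there fx∈ys = fx∈ys
  size′ : ∀ {z} → z ∈ ys → length (filter (λ x → f x ≟ z) rest) ≡ c
  size′ {z} z∈ys = trans
    (cong length (filter-filter (λ x → ¬? (f x ≟ y)) (λ x → f x ≟ z)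
      (λ { refl fx≡y → All.lookup y∉ys z∈ys (sym fx≡y) }) xs))
    (size (there z∈ys))

-- Iterates of a function of prime period

module _ (f : A → A) where

  fold-fixed : ∀ {z} → f z ≡ z → ∀ i → fold z f i ≡ z
  fold-fixed fz≡z zero    = refl
  fold-fixed fz≡z (suc i) = trans (cong f (fold-fixed fz≡z i)) fz≡z

  fold-+-period : ∀ {z p} → fold z f p ≡ z → ∀ k → fold z f (k + p) ≡ fold z f k
  fold-+-period {z} eq k = trans (fold-+ z f k) (cong (λ y → fold y f k) eq)

  fold-*-period : ∀ {z p} → fold z f p ≡ z → ∀ k → fold z f (k * p) ≡ z
  fold-*-period eq zero = refl
  fold-*-period {z} {p} eq (suc k) =
    trans (fold-+ z f p) (trans (cong (λ y → fold y f p) (fold-*-period eq k)) eq)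

  -- By Bézout some multiple of one period exceeds a multiple of the other by 1. Both multiples
  -- return `z` to itself, so the one extra application of `f` fixes it.
  fold-coprime : ∀ {z p d} → Coprime p d → fold z f p ≡ z → fold z f d ≡ z → f z ≡ z
  fold-coprime {z} {p} {d} coprime fp fd with coprime-Bézout coprime
  ... | Bézout.+- x y eq = trans (cong f (sym (fold-*-period fd y)))
          (trans (cong (fold z f) eq) (fold-*-period fp x))
  ... | Bézout.-+ x y eq = trans (cong f (sym (fold-*-period fp x)))
          (trans (cong (fold z f) eq) (fold-*-period fd y))

  module PrimeOrder {p} (prime : Prime p) (_≟_ : DecidableEquality A) where
    open DecMembership _≟_ using (_∈?_)

    private instance p≢0 = prime⇒nonZero prime

    orbit : A → List A
    orbit z = applyUpTo (fold z f) p

    ∈-orbit : ∀ {z} → fold z f p ≡ z → ∀ k → fold z f k ∈ orbit z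
    ∈-orbit {z} fp k = subst (_∈ orbit z) (sym eq) (∈-applyUpTo⁺ (fold z f) (m%n<n k p))
      where
      eq : fold z f k ≡ fold z f (k % p)
      eq = trans (cong (fold z f) (m≡m%n+[m/n]*n k p))
        (fold-+-period (fold-*-period fp (k / p)) (k % p))

    -- If the iterates `i < j` coincide, applying `f` another `p ∸ i` times turns this into a period
    -- `j ∸ i`. It is positive and below `p`, hence coprime to `p`, and `z` would be fixed.
    orbit-unique : ∀ {z} → fold z f p ≡ z → f z ≢ z → Unique (orbit z)
    orbit-unique {z} fp fz≢z = Unique.applyUpTo⁺₁ (fold z f) p distinct
      where
      distinct : ∀ {i j} → i < j → j < p → fold z f i ≢ fold z f j
      distinct {i} {j} i<j j<p eq = fz≢z
        (fold-coprime (prime⇒coprime prime (≤-<-trans (m∸n≤m j i) j<p)) fp (sym period))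
        where
        open ≡-Reasoning
        instance
          j∸i≢0 : NonZero (j ∸ i)
          j∸i≢0 = >-nonZero (m<n⇒0<n∸m i<j)
        i≤p = <⇒≤ (<-trans i<j j<p)
        shift : (p ∸ i) + j ≡ (j ∸ i) + p
        shift = begin
          (p ∸ i) + j             ≡⟨ cong ((p ∸ i) +_) (m∸n+n≡m (<⇒≤ i<j)) ⟨
          (p ∸ i) + (j ∸ i + i)   ≡⟨ cong ((p ∸ i) +_) (+-comm (j ∸ i) i) ⟩
          (p ∸ i) + (i + (j ∸ i)) ≡⟨ +-assoc (p ∸ i) i (j ∸ i) ⟨
          (p ∸ i + i) + (j ∸ i)   ≡⟨ cong (_+ (j ∸ i)) (m∸n+n≡m i≤p) ⟩
          p + (j ∸ i)             ≡⟨ +-comm p (j ∸ i) ⟩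
          (j ∸ i) + p             ∎
        period : z ≡ fold z f (j ∸ i)
        period = begin
          z                           ≡⟨ fp ⟨
          fold z f p                  ≡⟨ cong (fold z f) (m∸n+n≡m i≤p) ⟨
          fold z f (p ∸ i + i)        ≡⟨ fold-+ z f (p ∸ i) ⟩
          fold (fold z f i) f (p ∸ i) ≡⟨ cong (λ y → fold y f (p ∸ i)) eq ⟩
          fold (fold z f j) f (p ∸ i) ≡⟨ fold-+ z f (p ∸ i) ⟨
          fold z f (p ∸ i + j)        ≡⟨ cong (fold z f) shift ⟩
          fold z f (j ∸ i + p)        ≡⟨ fold-+-period fp (j ∸ i) ⟩
          fold z f (j ∸ i)            ∎

    private
      -- Orbits of exactly `p` elements are split off one at a time. The bound `n` makes the
      -- recursion structural; it may drop by one because an orbit is not empty.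
      length-free : ∀ n zs → length zs ≤ n → Unique zs →
        (∀ {z} → z ∈ zs → f z ∈ zs) → (∀ {z} → z ∈ zs → fold z f p ≡ z) →
        (∀ {z} → z ∈ zs → f z ≢ z) → ∃ λ c → length zs ≡ c * p
      length-free n [] _ _ _ _ _ = 0 , refl
      length-free (suc n) (z ∷ zs) (s≤s len) uniq closed fp free =
        suc (proj₁ ih) , trans split (cong₂ _+_ orbit-length (proj₂ ih))
        where
        all = z ∷ zs
        inside? = _∈? orbit z
        rest = filter (¬? ∘ inside?) all

        split : length all ≡ length (filter inside? all) + length rest
        split = length-filter-¬ inside? all

        fold∈ : ∀ k → fold z f k ∈ all
        fold∈ zero    = here refl
        fold∈ (suc k) = closed (fold∈ k)

        orbit⊆ : ∀ {x} → x ∈ orbit z → x ∈ all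
        orbit⊆ x∈ with ∈-applyUpTo⁻ (fold z f) x∈
        ... | k , _ , refl = fold∈ k

        fz≡ = fp (here refl)

        orbit-length : length (filter inside? all) ≡ p
        orbit-length = trans (≤-antisym
          (length-≤-⊆ (Unique.filter⁺ inside? uniq)
            (λ x∈ → proj₂ (∈-filter⁻ inside? {xs = all} x∈)))
          (length-≤-⊆ (orbit-unique fz≡ (free (here refl)))
            (λ x∈ → ∈-filter⁺ inside? (orbit⊆ x∈) x∈)))
          (length-applyUpTo (fold z f) p)

        rest⊆ : ∀ {x} → x ∈ rest → x ∈ all × x ∉ orbit z
        rest⊆ = ∈-filter⁻ (¬? ∘ inside?) {xs = all}

        -- The period supplies the inverse of `f`: `pred p` further steps lead from `f x` back to
        -- `x`, and they stay in the orbit.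
        stays : ∀ {x} → x ∈ all → f x ∈ orbit z → x ∈ orbit z
        stays {x} x∈ fx∈ with ∈-applyUpTo⁻ (fold z f) fx∈
        ... | k , _ , fx≡ = subst (_∈ orbit z) eq (∈-orbit fz≡ (pred p + k))
          where
          open ≡-Reasoning
          eq : fold z f (pred p + k) ≡ x
          eq = begin
            fold z f (pred p + k)        ≡⟨ fold-+ z f (pred p) ⟩
            fold (fold z f k) f (pred p) ≡⟨ cong (λ y → fold y f (pred p)) fx≡ ⟨
            fold (f x) f (pred p)        ≡⟨ fold-+ x f (pred p) ⟨
            fold x f (pred p + 1)        ≡⟨ cong (fold x f) (trans (+-comm (pred p) 1) (suc-pred p)) ⟩
            fold x f p                   ≡⟨ fp x∈ ⟩
            x                            ∎

        rest≤ : length rest ≤ n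
        rest≤ = ≤-trans (+-cancelˡ-≤ 1 _ _ (begin
          1 + length rest                                 ≤⟨ +-monoˡ-≤ (length rest) (≤-trans (>-nonZero⁻¹ p) (≤-reflexive (sym orbit-length))) ⟩
          length (filter inside? all) + length rest       ≡⟨ split ⟨
          length all                                      ∎)) len
          where open ≤-Reasoning

        ih : ∃ λ c → length rest ≡ c * p
        ih = length-free n rest rest≤
          (Unique.filter⁺ (¬? ∘ inside?) uniq)
          (λ x∈ → let x∈all , x∉ = rest⊆ x∈ in
            ∈-filter⁺ (¬? ∘ inside?) (closed x∈all) (x∉ ∘ stays x∈all))
          (fp ∘ proj₁ ∘ rest⊆)
          (free ∘ proj₁ ∘ rest⊆)

    -- The points that are not fixed fall into orbits of size `p`. They are closed under `f`, since
    -- a point whose image is fixed returns to itself after `p` steps and so equals that image.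
    length-fixed : ∀ {xs} → Unique xs →
      (∀ {x} → x ∈ xs → f x ∈ xs) → (∀ {x} → x ∈ xs → fold x f p ≡ x) →
      ∃ λ c → length xs ≡ length (filter (λ x → f x ≟ x) xs) + c * p
    length-fixed {xs} uniq closed fp =
      proj₁ free , trans (length-filter-¬ fixed? xs) (cong (length (filter fixed? xs) +_) (proj₂ free))
      where
      fixed? = λ x → f x ≟ x
      moved = filter (¬? ∘ fixed?) xs
      moved⊆ : ∀ {x} → x ∈ moved → x ∈ xs × f x ≢ x
      moved⊆ = ∈-filter⁻ (¬? ∘ fixed?) {xs = xs}
      still : ∀ {x} → x ∈ xs → f (f x) ≡ f x → f x ≡ x
      still {x} x∈ ffx = begin
        f x                   ≡⟨ fold-fixed ffx (pred p) ⟨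
        fold (f x) f (pred p) ≡⟨ fold-+ x f (pred p) ⟨
        fold x f (pred p + 1) ≡⟨ cong (fold x f) (trans (+-comm (pred p) 1) (suc-pred p)) ⟩
        fold x f p            ≡⟨ fp x∈ ⟩
        x                     ∎
        where open ≡-Reasoning
      free = length-free (length moved) moved ≤-refl
        (Unique.filter⁺ (¬? ∘ fixed?) uniq)
        (λ x∈ → let x∈xs , x≢ = moved⊆ x∈ in
          ∈-filter⁺ (¬? ∘ fixed?) (closed x∈xs) (x≢ ∘ still x∈xs))
        (fp ∘ proj₁ ∘ moved⊆)
        (proj₂ ∘ moved⊆)

length-cartesianProductWith : (f : A → B → C) → ∀ xs ys →
  length (cartesianProductWith f xs ys) ≡ length xs * length ys
length-cartesianProductWith f []       ys = refl
length-cartesianProductWith f (x ∷ xs) ys = trans (length-++ (map (f x) ys))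
  (cong₂ _+_ (length-map (f x) ys) (length-cartesianProductWith f xs ys))

-- Putting `z` in front of the smaller list keeps it duplicate-free and inside the larger one. This
-- gives the descent of both well-founded recursions below.
length-filter-< : {P Q : Pred A 0ℓ} (P? : Decidable P) (Q? : Decidable Q) →
  (∀ {x} → Q x → P x) → ∀ {xs z} → Unique xs → z ∈ xs → P z → ¬ Q z →
  length (filter Q? xs) < length (filter P? xs)
length-filter-< {P = P} P? Q? Q⇒P {xs} {z} uniq z∈ Pz ¬Qz = length-≤-⊆
  (All.tabulate (λ y∈ z≡y → ¬Qz (subst _ (sym z≡y) (proj₂ (∈-filter⁻ Q? {xs = xs} y∈))))
    ∷ Unique.filter⁺ Q? uniq)
  λ { (here refl) → ∈-filter⁺ P? z∈ Pz
    ; (there y∈) → let y∈xs , Qy = ∈-filter⁻ Q? {xs = xs} y∈ in ∈-filter⁺ P? y∈xs (Q⇒P Qy) }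

module _ {p} (prime : Prime p) where

  ∣-remove-multiple : ∀ {a b} → ∃ (λ c → a ≡ b + c * p) → p ∣ a → p ∣ b
  ∣-remove-multiple {a} {b} (c , eq) p∣a =
    ∣m+n∣m⇒∣n (subst (p ∣_) (trans eq (+-comm b (c * p))) p∣a) (n∣m*n c)

  -- The way a fixed-point count is exploited: one trivial fixed point is known, and `p ≥ 2` rules
  -- out that it is alone.
  another-element : ∀ {xs : List A} {x} → Unique xs → p ∣ length xs → x ∈ xs →
    ∃ λ y → y ∈ xs × y ≢ x
  another-element {xs = _ ∷ []} _ p∣1 _ =
    contradiction (∣⇒≤ p∣1) (<⇒≱ (nonTrivial⇒n>1 p {{prime⇒nonTrivial prime}}))
  another-element {xs = a ∷ b ∷ _} ((a≢b ∷ _) ∷ _) _ (here refl) = b , there (here refl) , a≢b ∘ sym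
  another-element {xs = a ∷ b ∷ _} (a≢ ∷ _) _ (there x∈) = a , here refl , All.lookup a≢ x∈

-- Words over a finite alphabet and their rotation

module Words {A : Set} (ys : List A) where

  words : ℕ → List (List A)
  words zero    = [ [] ]
  words (suc n) = cartesianProductWith _∷_ ys (words n)

  words-unique : Unique ys → ∀ n → Unique (words n)
  words-unique uniq zero    = [] ∷ []
  words-unique uniq (suc n) = Unique.cartesianProductWith⁺ _∷_ ∷-injective uniq (words-unique uniq n)

  ∈words⁺ : ∀ {w} → All (_∈ ys) w → w ∈ words (length w)
  ∈words⁺ []         = here refl
  ∈words⁺ (x∈ ∷ w∈)  = ∈-cartesianProductWith⁺ _∷_ x∈ (∈words⁺ w∈)

  ∈words⁻ : ∀ n {w} → w ∈ words n → length w ≡ n × All (_∈ ys) w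
  ∈words⁻ zero (here refl) = refl , []
  ∈words⁻ (suc n) w∈ with ∈-cartesianProductWith⁻ _∷_ ys (words n) w∈
  ... | _ , _ , x∈ , v∈ , refl = let len , all = ∈words⁻ n v∈ in cong suc len , x∈ ∷ all

  ∣-length-words : ∀ {d} n .{{_ : NonZero n}} → d ∣ length ys → d ∣ length (words n)
  ∣-length-words {d} (suc n) d∣ = subst (d ∣_)
    (sym (length-cartesianProductWith _∷_ ys (words n))) (∣m⇒∣m*n (length (words n)) d∣)

rotate : List A → List A
rotate []      = []
rotate (x ∷ w) = w ++ [ x ]

-- The suffix `v` is there for the induction: it collects the letters that have already been moved
-- to the end.
fold-rotate-++ : ∀ (w v : List A) → fold (w ++ v) rotate (length w) ≡ v ++ w
fold-rotate-++ []      v = sym (++-identityʳ v)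
fold-rotate-++ (x ∷ w) v = begin
  rotate (fold (x ∷ w ++ v) rotate (length w))    ≡⟨ fold-+ (x ∷ w ++ v) rotate 1 {length w} ⟨
  fold (x ∷ w ++ v) rotate (1 + length w)         ≡⟨ cong (fold (x ∷ w ++ v) rotate) (+-comm 1 (length w)) ⟩
  fold (x ∷ w ++ v) rotate (length w + 1)         ≡⟨ fold-+ (x ∷ w ++ v) rotate (length w) ⟩
  fold ((w ++ v) ++ [ x ]) rotate (length w)      ≡⟨ cong (λ u → fold u rotate (length w)) (++-assoc w v [ x ]) ⟩
  fold (w ++ (v ++ [ x ])) rotate (length w)      ≡⟨ fold-rotate-++ w (v ++ [ x ]) ⟩
  (v ++ [ x ]) ++ w                               ≡⟨ ++-assoc v [ x ] w ⟩
  v ++ x ∷ w                                      ∎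
  where open ≡-Reasoning

fold-rotate : ∀ (w : List A) → fold w rotate (length w) ≡ w
fold-rotate w = trans (cong (λ v → fold v rotate (length w)) (sym (++-identityʳ w))) (fold-rotate-++ w [])

-- Comparing first letters shows that the second letter is `x` again; what remains is the same
-- equation for a word shorter by one.
rotate-fixed : ∀ (w : List A) {x} → rotate (x ∷ w) ≡ x ∷ w → x ∷ w ≡ replicate (suc (length w)) x
rotate-fixed [] eq = refl
rotate-fixed (y ∷ w) {x} eq with ∷-injectiveˡ eq
... | refl = cong (x ∷_) (rotate-fixed w (∷-injectiveʳ eq))

rotate-replicate : ∀ n (x : A) → rotate (replicate n x) ≡ replicate n x
rotate-replicate zero          x = refl
rotate-replicate (suc zero)    x = refl
rotate-replicate (suc (suc n)) x = cong (x ∷_) (rotate-replicate (suc n) x)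

length-allFin : ∀ n → length (allFin n) ≡ n
length-allFin n = length-tabulate id

∈⇒length≢0 : {x : A} {xs : List A} → x ∈ xs → NonZero (length xs)
∈⇒length≢0 {xs = _ ∷ _} _ = _

-- Each use of Euclid's lemma extracts one factor `p` from `a`; cancelling it leaves the same claim
-- for exponent `k`.
^-∣-coprime : ∀ {p} → Prime p → ∀ k a {b} → ¬ p ∣ b → p ^ k ∣ a * b → p ^ k ∣ a
^-∣-coprime {p} pr zero    a p∤b _ = divides a (sym (*-identityʳ a))
^-∣-coprime {p} pr (suc k) a {b} p∤b pᵏ⁺¹∣ab with euclidsLemma a b pr (∣-trans (m∣m*n (p ^ k)) pᵏ⁺¹∣ab)
... | inj₂ p∣b = contradiction p∣b p∤b
... | inj₁ (divides q refl) = subst (p * p ^ k ∣_) (*-comm p q) (*-monoʳ-∣ p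
        (^-∣-coprime pr k q p∤b (*-cancelˡ-∣ p (subst (p * p ^ k ∣_) eq pᵏ⁺¹∣ab))))
  where
  instance p≢0 = prime⇒nonZero pr
  eq : (q * p) * b ≡ p * (q * b)
  eq = trans (cong (_* b) (*-comm q p)) (*-assoc p q b)

-- p-subgroups of a finite group

module FiniteGroup {m} {mul : Op₂ (Fin m)} {e} {inv : Op₁ (Fin m)}
  (isGroup : IsGroup _≡_ mul e inv) where

  group : Group 0ℓ 0ℓ
  group = record { isGroup = isGroup }

  open Group group using (_∙_; ε; _⁻¹; assoc; identityˡ; identityʳ; inverseˡ; inverseʳ) public
  open Algebra.Properties.Group group public
    using (\\-leftDividesˡ; \\-leftDividesʳ; ∙-cancelˡ; ∙-cancelʳ; inverseʳ-unique;
           ⁻¹-anti-homo-\\; ⁻¹-anti-homo-∙; ⁻¹-involutive; ε⁻¹≈ε)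

  infixl 8 _^^_
  _^^_ : Fin m → ℕ → Fin m
  x ^^ n = fold ε (x ∙_) n

  ^^-+ : ∀ x i j → x ^^ (i + j) ≡ x ^^ i ∙ x ^^ j
  ^^-+ x zero    j = sym (identityˡ _)
  ^^-+ x (suc i) j = trans (cong (x ∙_) (^^-+ x i j)) (sym (assoc x _ _))

  -- Two of the exponents `0, ..., m` give the same power of `x`. If they differ by `suc k`, then
  -- `x ^^ suc k` is `ε`, and the inverse is `x ^^ k`.
  ⁻¹-power : ∀ x → ∃ λ k → x ⁻¹ ≡ x ^^ k
  ⁻¹-power x with pigeonhole (n<1+n m) (λ i → x ^^ toℕ i)
  ... | i , j , i<j , eq with toℕ j ∸ toℕ i in d
  ...   | zero  = contradiction (subst (0 <_) d (m<n⇒0<n∸m i<j)) λ ()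
  ...   | suc k = k , sym (inverseʳ-unique x (x ^^ k) (∙-cancelˡ (x ^^ toℕ i) _ _ (begin
      x ^^ toℕ i ∙ x ^^ suc k            ≡⟨ ^^-+ x (toℕ i) (suc k) ⟨
      x ^^ (toℕ i + suc k)               ≡⟨ cong (λ e → x ^^ (toℕ i + e)) d ⟨
      x ^^ (toℕ i + (toℕ j ∸ toℕ i))     ≡⟨ cong (x ^^_) (m+[n∸m]≡n (<⇒≤ i<j)) ⟩
      x ^^ toℕ j                         ≡⟨ eq ⟨
      x ^^ toℕ i                         ≡⟨ identityʳ _ ⟨
      x ^^ toℕ i ∙ ε                     ∎)))
      where open ≡-Reasoning

  -- A finite submonoid of a group is closed under inverses (⁻¹∈ below).
  record Subgroup : Set₁ where
    field
      Mem  : Pred (Fin m) 0ℓ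
      mem? : Decidable Mem
      ε∈   : Mem ε
      ∙∈   : ∀ {x y} → Mem x → Mem y → Mem (x ∙ y)

    ^^∈ : ∀ {x} → Mem x → ∀ i → Mem (x ^^ i)
    ^^∈ x∈ zero    = ε∈
    ^^∈ x∈ (suc i) = ∙∈ x∈ (^^∈ x∈ i)

    ⁻¹∈ : ∀ {x} → Mem x → Mem (x ⁻¹)
    ⁻¹∈ {x} x∈ = let k , eq = ⁻¹-power x in subst Mem (sym eq) (^^∈ x∈ k)

    elements : List (Fin m)
    elements = filter mem? (allFin m)

    infix 4 _~_
    -- Lying in the same left coset. Left multiplication by any element respects this, whereas right
    -- multiplication will require normality.
    _~_ : Fin m → Fin m → Set
    x ~ y = Mem (x ⁻¹ ∙ y)

    ~-refl : ∀ {x} → x ~ x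
    ~-refl {x} = subst Mem (sym (inverseˡ x)) ε∈

    ~-sym : ∀ {x y} → x ~ y → y ~ x
    ~-sym {x} {y} x~y = subst Mem (⁻¹-anti-homo-\\ x y) (⁻¹∈ x~y)

    ~-trans : ∀ {x y z} → x ~ y → y ~ z → x ~ z
    ~-trans {x} {y} {z} x~y y~z = subst Mem
      (trans (assoc (x ⁻¹) y (y ⁻¹ ∙ z)) (cong (x ⁻¹ ∙_) (\\-leftDividesˡ y z))) (∙∈ x~y y~z)

    ~-∙ˡ : ∀ g {x y} → x ~ y → (g ∙ x) ~ (g ∙ y)
    ~-∙ˡ g {x} {y} = subst Mem (begin
      x ⁻¹ ∙ y                   ≡⟨ cong (x ⁻¹ ∙_) (\\-leftDividesʳ g y) ⟨
      x ⁻¹ ∙ (g ⁻¹ ∙ (g ∙ y))    ≡⟨ assoc (x ⁻¹) (g ⁻¹) (g ∙ y) ⟨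
      (x ⁻¹ ∙ g ⁻¹) ∙ (g ∙ y)    ≡⟨ cong (_∙ (g ∙ y)) (⁻¹-anti-homo-∙ g x) ⟨
      (g ∙ x) ⁻¹ ∙ (g ∙ y)       ∎)
      where open ≡-Reasoning

    ~-∙ʳ : ∀ x {h} → Mem h → x ~ (x ∙ h)
    ~-∙ʳ x {h} = subst Mem (sym (\\-leftDividesʳ x h))

    private
      first : Fin m → List (Fin m) → Fin m
      first x []      = x
      first x (y ∷ _) = y

      first∈ : ∀ x {y ys} → y ∈ ys → first x ys ∈ ys
      first∈ x {ys = _ ∷ _} _ = here refl

      first-irrelevant : ∀ x x′ {y ys} → y ∈ ys → first x ys ≡ first x′ ys
      first-irrelevant x x′ {ys = _ ∷ _} _ = refl

      coset : Fin m → List (Fin m)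
      coset x = filter (λ y → mem? (x ⁻¹ ∙ y)) (allFin m)

      ∈coset : ∀ {x y} → x ~ y → y ∈ coset x
      ∈coset {x} {y} = ∈-filter⁺ (λ y → mem? (x ⁻¹ ∙ y)) (∈-allFin y)

    -- Stands in for the quotient: equivalent elements have the same filtered list as coset, hence
    -- the same first entry. The default `x` of `first` is never returned, because a coset contains
    -- its own `x`.
    rep : Fin m → Fin m
    rep x = first x (coset x)

    rep-~ : ∀ x → x ~ rep x
    rep-~ x = proj₂ (∈-filter⁻ (λ y → mem? (x ⁻¹ ∙ y)) {xs = allFin m}
      (first∈ x (∈coset {x} {x} ~-refl)))

    ~⇒rep≡ : ∀ {x y} → x ~ y → rep x ≡ rep y
    ~⇒rep≡ {x} {y} x~y = trans
      (cong (first x) (filter-≐ _ _ (~-trans (~-sym x~y) , ~-trans x~y) (allFin m)))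
      (first-irrelevant x y (∈coset {y} ~-refl))

    rep≡⇒~ : ∀ {x y} → rep x ≡ rep y → x ~ y
    rep≡⇒~ {x} {y} eq = ~-trans (rep-~ x) (subst (_~ y) (sym eq) (~-sym (rep-~ y)))

    rep-rep : ∀ x → rep (rep x) ≡ rep x
    rep-rep x = sym (~⇒rep≡ (rep-~ x))

    transversal : List (Fin m)
    transversal = filter (λ x → rep x ≟ x) (allFin m)

    rep∈transversal : ∀ x → rep x ∈ transversal
    rep∈transversal x = ∈-filter⁺ (λ x → rep x ≟ x) (∈-allFin (rep x)) (rep-rep x)

    ∈transversal⇒rep≡ : ∀ {x} → x ∈ transversal → rep x ≡ x
    ∈transversal⇒rep≡ x∈ = proj₂ (∈-filter⁻ (λ x → rep x ≟ x) {xs = allFin m} x∈)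

    transversal-unique : Unique transversal
    transversal-unique = Unique.filter⁺ (λ x → rep x ≟ x) (Unique.allFin⁺ m)

    rep≡ε⇒Mem : ∀ {x} → rep x ≡ rep ε → Mem x
    rep≡ε⇒Mem {x} eq = subst Mem (trans (cong (_∙ x) ε⁻¹≈ε) (identityˡ x)) (~-sym (rep≡⇒~ eq))

    Mem⇒rep≡ε : ∀ {x} → Mem x → rep x ≡ rep ε
    Mem⇒rep≡ε {x} x∈ = sym (~⇒rep≡ (subst (ε ~_) (identityˡ x) (~-∙ʳ ε x∈)))

    -- Lagrange's theorem for a union of left cosets. The whole group is one instance; the other is
    -- the set of elements whose inverses send `ω` into a given orbit.
    length-union-of-cosets : ∀ {A : Pred (Fin m) 0ℓ} (A? : Decidable A) →
      (∀ {x h} → A x → Mem h → A (x ∙ h)) →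
      length (filter A? (allFin m)) ≡ length (filter A? transversal) * length elements
    length-union-of-cosets {A} A? A∙ =
      length-fibres _≟_ rep (length elements) (filter A? (allFin m)) (Unique.filter⁺ A? transversal-unique)
        (λ {x} x∈ → ∈-filter⁺ A? (rep∈transversal x)
          (A-resp (rep-~ x) (proj₂ (∈-filter⁻ A? {xs = allFin m} x∈))))
        size
      where
      A-resp : ∀ {x y} → x ~ y → A x → A y
      A-resp {x} {y} x~y Ax = subst A (\\-leftDividesˡ x y) (A∙ Ax x~y)
      size : ∀ {y} → y ∈ filter A? transversal →
        length (filter (λ x → rep x ≟ y) (filter A? (allFin m))) ≡ length elements
      size {y} y∈ with ∈-filter⁻ A? {xs = transversal} y∈
      ... | y∈t , Ay = ≤-antisym
        (length-≤-injection (y ⁻¹ ∙_)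
          (Unique.filter⁺ _ (Unique.filter⁺ A? (Unique.allFin⁺ m)))
          (λ _ _ → ∙-cancelˡ (y ⁻¹) _ _)
          (λ {x} x∈ → ∈-filter⁺ mem? (∈-allFin _)
            (rep≡⇒~ (trans (∈transversal⇒rep≡ y∈t)
              (sym (proj₂ (∈-filter⁻ (λ x → rep x ≟ y) {xs = filter A? (allFin m)} x∈)))))))
        (length-≤-injection (y ∙_) (Unique.filter⁺ mem? (Unique.allFin⁺ m))
          (λ _ _ → ∙-cancelˡ y _ _)
          λ {h} h∈ → let Hh = proj₂ (∈-filter⁻ mem? {xs = allFin m} h∈) in
            ∈-filter⁺ (λ x → rep x ≟ y) (∈-filter⁺ A? (∈-allFin _) (A∙ Ay Hh))
              (trans (sym (~⇒rep≡ (~-∙ʳ y Hh))) (∈transversal⇒rep≡ y∈t)))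

  open Subgroup using (Mem)

  trivial : Subgroup
  trivial = record
    { Mem  = _≡ ε
    ; mem? = _≟ ε
    ; ε∈   = refl
    ; ∙∈   = λ { refl refl → identityˡ ε }
    }

  -- The inclusion of `Hx` in `xH`, a form that composes without inverses. In a finite group it is
  -- an equality, and inverses normalise as well because they are powers.
  record Normalises (x : Fin m) (H : Subgroup) : Set where
    field
      commute : ∀ {h} → Mem H h → ∃ λ k → Mem H k × h ∙ x ≡ x ∙ k

  open Normalises

  normalises-^^ : ∀ {H x} → Normalises x H → ∀ i → Normalises (x ^^ i) H
  commute (normalises-^^ nx zero) {h} h∈ = h , h∈ , trans (identityʳ h) (sym (identityˡ h))
  commute (normalises-^^ {H} {x} nx (suc i)) {h} h∈ with commute nx h∈
  ... | k , k∈ , hx≡xk with commute (normalises-^^ nx i) k∈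
  ...   | l , l∈ , eq = l , l∈ , (begin
    h ∙ (x ∙ x ^^ i)   ≡⟨ assoc h x (x ^^ i) ⟨
    (h ∙ x) ∙ x ^^ i   ≡⟨ cong (_∙ x ^^ i) hx≡xk ⟩
    (x ∙ k) ∙ x ^^ i   ≡⟨ assoc x k (x ^^ i) ⟩
    x ∙ (k ∙ x ^^ i)   ≡⟨ cong (x ∙_) eq ⟩
    x ∙ (x ^^ i ∙ l)   ≡⟨ assoc x (x ^^ i) l ⟨
    (x ∙ x ^^ i) ∙ l   ∎)
    where open ≡-Reasoning

  module _ (H : Subgroup) (x : Fin m) (nx : Normalises x H) (p : ℕ) .{{_ : NonZero p}}
    (xᵖ∈H : Mem H (x ^^ p)) where
    open Subgroup H hiding (Mem)

    -- The group generated by `H` and `x`. Unbounded exponents make closure under products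
    -- immediate; membership is decidable because `x ^^ p` lies in `H`, so that the exponent can be
    -- reduced modulo `p`.
    extend : Subgroup
    extend = record
      { Mem  = λ y → ∃ λ i → ∃ λ h → Mem H h × y ≡ x ^^ i ∙ h
      ; mem? = λ y → map′
          (λ (i , h∈) → toℕ i , _ , h∈ , sym (\\-leftDividesˡ (x ^^ toℕ i) y))
          (λ (i , h , h∈ , eq) → fromℕ< (m%n<n i p) , reduce y i h h∈ eq)
          (any? λ (i : Fin p) → mem? ((x ^^ toℕ i) ⁻¹ ∙ y))
      ; ε∈   = 0 , ε , ε∈ , sym (identityˡ ε)
      ; ∙∈   = λ { (i , h , h∈ , refl) (j , k , k∈ , refl) →
                   let l , l∈ , eq = commute (normalises-^^ nx j) h∈
                   in i + j , l ∙ k , ∙∈ l∈ k∈ , mult i j h k l eq }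
      }
      where
      open ≡-Reasoning
      multiples : ∀ q → Mem H (x ^^ (q * p))
      multiples zero    = ε∈
      multiples (suc q) = subst (Mem H) (sym (^^-+ x p (q * p))) (∙∈ xᵖ∈H (multiples q))

      reduce : ∀ y i h → Mem H h → y ≡ x ^^ i ∙ h → Mem H ((x ^^ toℕ (fromℕ< (m%n<n i p))) ⁻¹ ∙ y)
      reduce y i h h∈ refl = subst (Mem H) (sym (begin
        (x ^^ toℕ (fromℕ< (m%n<n i p))) ⁻¹ ∙ (x ^^ i ∙ h) ≡⟨ cong (λ e → (x ^^ e) ⁻¹ ∙ (x ^^ i ∙ h)) (toℕ-fromℕ< (m%n<n i p)) ⟩
        r ⁻¹ ∙ (x ^^ i ∙ h)             ≡⟨ cong (λ e → r ⁻¹ ∙ (x ^^ e ∙ h)) (m≡m%n+[m/n]*n i p) ⟩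
        r ⁻¹ ∙ (x ^^ (i % p + i / p * p) ∙ h) ≡⟨ cong (λ e → r ⁻¹ ∙ (e ∙ h)) (^^-+ x (i % p) (i / p * p)) ⟩
        r ⁻¹ ∙ ((r ∙ q) ∙ h)            ≡⟨ cong (r ⁻¹ ∙_) (assoc r q h) ⟩
        r ⁻¹ ∙ (r ∙ (q ∙ h))            ≡⟨ \\-leftDividesʳ r (q ∙ h) ⟩
        q ∙ h                           ∎)) (∙∈ (multiples (i / p)) h∈)
        where
        r = x ^^ (i % p)
        q = x ^^ (i / p * p)

      mult : ∀ i j h k l → h ∙ x ^^ j ≡ x ^^ j ∙ l →
        (x ^^ i ∙ h) ∙ (x ^^ j ∙ k) ≡ x ^^ (i + j) ∙ (l ∙ k)
      mult i j h k l eq = begin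
        (x ^^ i ∙ h) ∙ (x ^^ j ∙ k)   ≡⟨ assoc (x ^^ i) h (x ^^ j ∙ k) ⟩
        x ^^ i ∙ (h ∙ (x ^^ j ∙ k))   ≡⟨ cong (x ^^ i ∙_) (assoc h (x ^^ j) k) ⟨
        x ^^ i ∙ ((h ∙ x ^^ j) ∙ k)   ≡⟨ cong (λ e → x ^^ i ∙ (e ∙ k)) eq ⟩
        x ^^ i ∙ ((x ^^ j ∙ l) ∙ k)   ≡⟨ cong (x ^^ i ∙_) (assoc (x ^^ j) l k) ⟩
        x ^^ i ∙ (x ^^ j ∙ (l ∙ k))   ≡⟨ assoc (x ^^ i) (x ^^ j) (l ∙ k) ⟨
        (x ^^ i ∙ x ^^ j) ∙ (l ∙ k)   ≡⟨ cong (_∙ (l ∙ k)) (^^-+ x i j) ⟨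
        x ^^ (i + j) ∙ (l ∙ k)        ∎

  -- The laws are asked for on `xs` alone: an action on cosets is written as a product followed by
  -- `rep`, and there the identity fixes only the canonical representatives.
  record IsAction {B : Set} (H : Subgroup) (act : Fin m → B → B) (xs : List B) : Set where
    field
      closed : ∀ {g b} → Mem H g → b ∈ xs → act g b ∈ xs
      act-ε  : ∀ {b} → b ∈ xs → act ε b ≡ b
      act-∙  : ∀ {g h b} → Mem H g → Mem H h → b ∈ xs → act (g ∙ h) b ≡ act g (act h b)

  module _ {p} (prime : Prime p) where
    private instance p≢0 = prime⇒nonZero prime

    -- Towers of normal extensions by an x with xᵖ ∈ H: counting fixed points reduces to a single permutation
    -- of order dividing p at each step, without orders or orbit sizes.
    data IsPGroup : Subgroup → Set₁ where
      trivial-p : IsPGroup trivial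
      extend-p  : ∀ {H} → IsPGroup H → ∀ x (nx : Normalises x H) (xᵖ∈H : Mem H (x ^^ p)) →
                  IsPGroup (extend H x nx p xᵖ∈H)

    -- Since `x` normalises `H`, it permutes the points fixed by `H`, and on these `x ^^ p`, an
    -- element of `H`, acts trivially. So `length-fixed` applies to `x`, and the points it keeps are
    -- those fixed by the extension.
    fixed-points : ∀ {H} → IsPGroup H → {B : Set} → DecidableEquality B →
      (act : Fin m → B → B) {xs : List B} → Unique xs → IsAction H act xs →
      Σ (List B) λ ys → Unique ys ×
        (∀ {y} → y ∈ ys → y ∈ xs × (∀ {h} → Mem H h → act h y ≡ y)) ×
        (∀ {y} → y ∈ xs → (∀ {h} → Mem H h → act h y ≡ y) → y ∈ ys) ×
        ∃ λ c → length xs ≡ length ys + c * p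
    fixed-points trivial-p _≟ᵇ_ act {xs} uniq isAction =
      xs , uniq , (λ y∈ → y∈ , λ { refl → act-ε y∈ }) , (λ y∈ _ → y∈) , 0 , sym (+-identityʳ _)
      where open IsAction isAction
    fixed-points (extend-p {H} pH x nx xᵖ∈H) _≟ᵇ_ act {xs} uniq isAction
      with fixed-points pH _≟ᵇ_ act uniq (record
        { closed = λ g∈ → closed (H⊆ g∈)
        ; act-ε  = act-ε
        ; act-∙  = λ g∈ h∈ → act-∙ (H⊆ g∈) (H⊆ h∈) })
      where
      open IsAction isAction
      H⊆ : ∀ {h} → Mem H h → Mem (extend H x nx p xᵖ∈H) h
      H⊆ {h} h∈ = 0 , h , h∈ , sym (identityˡ h)
    ... | ys , ys-unique , ys⇒ , ⇒ys , c , eq =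
      zs , Unique.filter⁺ fixed? ys-unique , zs⇒ , ⇒zs , proj₁ lf + c ,
      trans eq (trans (cong (_+ c * p) (proj₂ lf)) (trans (+-assoc (length zs) _ _)
        (cong (length zs +_) (sym (*-distribʳ-+ p (proj₁ lf) c)))))
      where
      open IsAction isAction
      open ≡-Reasoning
      K = extend H x nx p xᵖ∈H
      H⊆ : ∀ {h} → Mem H h → Mem K h
      H⊆ {h} h∈ = 0 , h , h∈ , sym (identityˡ h)

      x^∈ : ∀ i → Mem K (x ^^ i)
      x^∈ i = i , ε , Subgroup.ε∈ H , sym (identityʳ _)

      x∈ : Mem K x
      x∈ = subst (Mem K) (identityʳ x) (x^∈ 1)

      fixed? = λ y → act x y ≟ᵇ y
      zs = filter fixed? ys

      fold-act : ∀ {y} → y ∈ xs → ∀ i → fold y (act x) i ≡ act (x ^^ i) y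
      fold-act y∈ zero    = sym (act-ε y∈)
      fold-act y∈ (suc i) = trans (cong (act x) (fold-act y∈ i)) (sym (act-∙ x∈ (x^∈ i) y∈))

      closed-ys : ∀ {y} → y ∈ ys → act x y ∈ ys
      closed-ys {y} y∈ with ys⇒ y∈
      ... | y∈xs , fixed = ⇒ys (closed x∈ y∈xs) λ {h} h∈ →
        let k , k∈ , hx≡xk = commute nx h∈ in begin
          act h (act x y)  ≡⟨ act-∙ (H⊆ h∈) x∈ y∈xs ⟨
          act (h ∙ x) y    ≡⟨ cong (λ g → act g y) hx≡xk ⟩
          act (x ∙ k) y    ≡⟨ act-∙ x∈ (H⊆ k∈) y∈xs ⟩
          act x (act k y)  ≡⟨ cong (act x) (fixed k∈) ⟩
          act x y          ∎

      lf = PrimeOrder.length-fixed (act x) prime _≟ᵇ_ ys-unique closed-ys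
        (λ y∈ → let y∈xs , fixed = ys⇒ y∈ in trans (fold-act y∈xs p) (fixed xᵖ∈H))

      zs⇒ : ∀ {y} → y ∈ zs → y ∈ xs × (∀ {h} → Mem K h → act h y ≡ y)
      zs⇒ {y} y∈zs with ∈-filter⁻ fixed? {xs = ys} y∈zs
      ... | y∈ys , xy≡y with ys⇒ y∈ys
      ...   | y∈xs , fixed = y∈xs , λ { (i , h , h∈ , refl) → begin
        act (x ^^ i ∙ h) y       ≡⟨ act-∙ (x^∈ i) (H⊆ h∈) y∈xs ⟩
        act (x ^^ i) (act h y)   ≡⟨ cong (act (x ^^ i)) (fixed h∈) ⟩
        act (x ^^ i) y           ≡⟨ fold-act y∈xs i ⟨
        fold y (act x) i         ≡⟨ fold-fixed (act x) xy≡y i ⟩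
        y                        ∎ }

      ⇒zs : ∀ {y} → y ∈ xs → (∀ {h} → Mem K h → act h y ≡ y) → y ∈ zs
      ⇒zs y∈xs fixed = ∈-filter⁺ fixed? (⇒ys y∈xs (fixed ∘ H⊆)) (fixed x∈)

-- Sylow subgroups

module Sylow {m} {mul : Op₂ (Fin m)} {e} {inv : Op₁ (Fin m)}
  (isGroup : IsGroup _≡_ mul e inv) where
  open FiniteGroup isGroup
  open Normalises
  open Subgroup using (Mem; mem?; ε∈; ∙∈; ⁻¹∈; rep; transversal; rep-rep)

  -- The measure that decreases whenever a subgroup is enlarged, both in the Sylow tower and along
  -- the central series.
  complement-size : Subgroup → ℕ
  complement-size H = length (filter (¬? ∘ mem? H) (allFin m))

  Π : List (Fin m) → Fin m
  Π = foldr _∙_ ε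

  Π-++ : ∀ v w → Π (v ++ w) ≡ Π v ∙ Π w
  Π-++ []      w = sym (identityˡ _)
  Π-++ (x ∷ v) w = trans (cong (x ∙_) (Π-++ v w)) (sym (assoc x (Π v) (Π w)))

  Π-replicate : ∀ n x → Π (replicate n x) ≡ x ^^ n
  Π-replicate zero    x = refl
  Π-replicate (suc n) x = cong (x ∙_) (Π-replicate n x)

  module _ {H : Subgroup} where

    normalises-∙ : ∀ {x y} → Normalises x H → Normalises y H → Normalises (x ∙ y) H
    commute (normalises-∙ {x} {y} nx ny) {h} h∈ with commute nx h∈
    ... | k , k∈ , hx≡xk with commute ny k∈
    ...   | l , l∈ , ky≡yl = l , l∈ , (begin
      h ∙ (x ∙ y)  ≡⟨ assoc h x y ⟨
      (h ∙ x) ∙ y  ≡⟨ cong (_∙ y) hx≡xk ⟩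
      (x ∙ k) ∙ y  ≡⟨ assoc x k y ⟩
      x ∙ (k ∙ y)  ≡⟨ cong (x ∙_) ky≡yl ⟩
      x ∙ (y ∙ l)  ≡⟨ assoc x y l ⟨
      (x ∙ y) ∙ l  ∎)
      where open ≡-Reasoning

    normalises-ε : Normalises ε H
    commute normalises-ε {h} h∈ = h , h∈ , trans (identityʳ h) (sym (identityˡ h))

    normalises-⁻¹ : ∀ {x} → Normalises x H → Normalises (x ⁻¹) H
    normalises-⁻¹ {x} nx = let k , eq = ⁻¹-power x in
      subst (λ y → Normalises y H) (sym eq) (normalises-^^ nx k)

    Mem⇒normalises : ∀ {x} → Mem H x → Normalises x H
    commute (Mem⇒normalises {x} x∈) {h} h∈ = x ⁻¹ ∙ (h ∙ x) , ∙∈ H (⁻¹∈ H x∈) (∙∈ H h∈ x∈) ,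
      sym (\\-leftDividesˡ x (h ∙ x))

    normalises-Π : ∀ {w} → All (λ x → Normalises x H) w → Normalises (Π w) H
    normalises-Π []        = normalises-ε
    normalises-Π (nx ∷ nw) = normalises-∙ nx (normalises-Π nw)

    -- Conjugating `x ∙ y` by `x` gives `y ∙ x`. For words this says that moving the first letter to
    -- the end keeps the product in `H`.
    Mem-swap : ∀ {x y} → Normalises x H → Mem H (x ∙ y) → Mem H (y ∙ x)
    Mem-swap {x} {y} nx xy∈ with commute nx xy∈
    ... | k , k∈ , eq = subst (Mem H) (sym (∙-cancelˡ x _ _ (trans (sym (assoc x y x)) eq))) k∈

    ~⇒normalises : ∀ {x y} → Subgroup._~_ H x y → Normalises x H → Normalises y H
    ~⇒normalises {x} {y} x~y nx = subst (λ z → Normalises z H) (\\-leftDividesˡ x y)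
      (normalises-∙ nx (Mem⇒normalises x~y))

  module _ {p} (prime : Prime p) where
    private instance p≢0 = prime⇒nonZero prime

    -- McKay's argument in N(H)/H: rotation acts on the words of length p over ys whose product lies in H.
    cauchy : ∀ H {ys} → Unique ys → (∀ {y} → y ∈ ys → rep H y ≡ y × Normalises y H) →
      (∀ {y} → rep H y ≡ y → Normalises y H → y ∈ ys) → p ∣ length ys →
      ∃ λ x → ¬ Mem H x × Normalises x H × Mem H (x ^^ p)
    cauchy H {ys} uniq ys⇒ ⇒ys p∣ys = constant v v∈ v≢
      where
      open Subgroup H using (_~_; ~-sym; ~⇒rep≡; rep-~; rep≡⇒~; Mem⇒rep≡ε)
      open Words ys

      1+[p-1] : suc (pred p) ≡ p
      1+[p-1] = suc-pred p

      -- A word with product in `H` is determined by its last `pred p` letters: its first letter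
      -- must represent the coset of the inverse of their product.
      head : List (Fin m) → Fin m
      head w = rep H (Π w ⁻¹)

      X = map (λ w → head w ∷ w) (words (pred p))

      ys-normalise : ∀ {w} → All (_∈ ys) w → Normalises (Π w) H
      ys-normalise w∈ = normalises-Π (All.map (λ y∈ → proj₂ (ys⇒ y∈)) w∈)

      X⇒ : ∀ {v} → v ∈ X → length v ≡ p × All (_∈ ys) v × Mem H (Π v)
      X⇒ v∈ with ∈-map⁻ (λ w → head w ∷ w) v∈
      ... | w , w∈ , refl with ∈words⁻ (pred p) w∈
      ...   | len , all = trans (cong suc len) 1+[p-1] ,
        ⇒ys (rep-rep H _) (~⇒normalises (rep-~ _) (normalises-⁻¹ n)) ∷ all ,
        Mem-swap n (subst (λ q → Mem H (q ∙ head w)) (⁻¹-involutive (Π w)) (rep-~ (Π w ⁻¹)))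
        where
        n : Normalises (Π w) H
        n = ys-normalise all

      ⇒X : ∀ {v} → length v ≡ p → All (_∈ ys) v → Mem H (Π v) → v ∈ X
      ⇒X {[]} len = contradiction (trans len (sym 1+[p-1])) λ ()
      ⇒X {u ∷ w} len (u∈ ∷ w∈) uq∈ = subst (λ z → z ∷ w ∈ X)
        (trans (~⇒rep≡ {Π w ⁻¹} {u} (subst (λ q → Mem H (q ∙ u)) (sym (⁻¹-involutive (Π w)))
          (Mem-swap (proj₂ (ys⇒ u∈)) uq∈))) (proj₁ (ys⇒ u∈)))
        (∈-map⁺ (λ w → head w ∷ w) (subst (λ n → w ∈ words n)
          (suc-injective (trans len (sym 1+[p-1]))) (∈words⁺ w∈)))

      X-unique : Unique X
      X-unique = Unique.map⁺ ∷-injectiveʳ (words-unique uniq (pred p))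

      rotate-closed : ∀ {v} → v ∈ X → rotate v ∈ X
      rotate-closed {v} v∈ with X⇒ v∈
      rotate-closed {[]}    v∈ | len , _ , _ = contradiction (trans len (sym 1+[p-1])) λ ()
      rotate-closed {u ∷ w} v∈ | len , u∈ ∷ w∈ , uq∈ = ⇒X
        (trans (length-++ w) (trans (+-comm (length w) 1) len))
        (All.++⁺ w∈ (u∈ ∷ []))
        (subst (Mem H) (trans (cong (Π w ∙_) (sym (identityʳ u))) (sym (Π-++ w [ u ])))
          (Mem-swap (proj₂ (ys⇒ u∈)) uq∈))

      rotate-period : ∀ {v} → v ∈ X → fold v rotate p ≡ v
      rotate-period {v} v∈ = trans (cong (fold v rotate) (sym (proj₁ (X⇒ v∈)))) (fold-rotate v)

      _≟ʷ_ = ≡-dec (_≟_ {m})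
      fixed? = λ v → rotate v ≟ʷ v

      -- The number of words is `length ys` to the power `pred p`, and this exponent is positive
      -- because `p ≥ 2`.
      p∣X : p ∣ length X
      p∣X = subst (p ∣_) (sym (length-map (λ w → head w ∷ w) (words (pred p))))
        (∣-length-words (pred p) {{>-nonZero (pred-mono-≤ (nonTrivial⇒n>1 p {{prime⇒nonTrivial prime}}))}} p∣ys)

      p∣fixed : p ∣ length (filter fixed? X)
      p∣fixed = ∣-remove-multiple prime
        (PrimeOrder.length-fixed rotate prime _≟ʷ_ X-unique rotate-closed rotate-period) p∣X

      rep-ε∈H : Mem H (rep H ε)
      rep-ε∈H = Subgroup.rep≡ε⇒Mem H (rep-rep H ε)

      -- The trivial fixed word. Any other fixed word repeats a single letter `x`, its product
      -- `x ^^ p` lies in `H`, and `x` itself does not, since otherwise `x` would be `rep H ε`.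
      v₀ = replicate p (rep H ε)

      v₀∈ : v₀ ∈ filter fixed? X
      v₀∈ = ∈-filter⁺ fixed?
        (⇒X (length-replicate p) (All.replicate⁺ p (⇒ys (rep-rep H ε) (Mem⇒normalises rep-ε∈H)))
          (subst (Mem H) (sym (Π-replicate p _)) (Subgroup.^^∈ H rep-ε∈H p)))
        (rotate-replicate p _)

      other = another-element prime (Unique.filter⁺ fixed? X-unique) p∣fixed v₀∈
      v = proj₁ other
      v∈ = ∈-filter⁻ fixed? {xs = X} (proj₁ (proj₂ other))
      v≢ = proj₂ (proj₂ other)

      constant : ∀ v → v ∈ X × rotate v ≡ v → v ≢ v₀ →
        ∃ λ x → ¬ Mem H x × Normalises x H × Mem H (x ^^ p)
      constant v (v∈ , fixed) v≢ with X⇒ v∈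
      constant []      (v∈ , fixed) v≢ | len , _ = contradiction (trans len (sym 1+[p-1])) λ ()
      constant (x ∷ w) (v∈ , fixed) v≢ | len , x∈ ∷ w∈ , xq∈ =
        x ,
        (λ x∈H → v≢ (trans v≡ (cong (replicate p) (trans (sym (proj₁ (ys⇒ x∈))) (Mem⇒rep≡ε x∈H))))) ,
        proj₂ (ys⇒ x∈) ,
        subst (Mem H) (trans (cong Π v≡) (Π-replicate p x)) xq∈
        where
        v≡ : x ∷ w ≡ replicate p x
        v≡ = trans (rotate-fixed w fixed) (cong (λ n → replicate n x) len)

    -- Let `H` act on its left cosets by left multiplication. The coset of `y` is fixed exactly when
    -- `y` normalises `H`, so `p` divides the order of the normaliser modulo `H`, and `cauchy`
    -- applies there.
    enlarge : ∀ {H} → IsPGroup prime H → p ∣ length (transversal H) →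
      ∃ λ x → ¬ Mem H x × Normalises x H × Mem H (x ^^ p)
    enlarge {H} pH p∣t with fixed-points prime pH _≟_ (λ g y → rep H (g ∙ y)) (Subgroup.transversal-unique H) (record
      { closed = λ {g} {y} _ _ → Subgroup.rep∈transversal H (g ∙ y)
      ; act-ε  = λ {y} y∈ → trans (cong (rep H) (identityˡ y)) (∈transversal⇒rep≡ y∈)
      ; act-∙  = λ {g} {h} {y} _ _ _ → trans (cong (rep H) (assoc g h y)) (~⇒rep≡ (~-∙ˡ g (rep-~ (h ∙ y))))
      })
      where open Subgroup H using (∈transversal⇒rep≡; ~⇒rep≡; ~-∙ˡ; rep-~)
    ... | ys , ys-unique , ys⇒ , ⇒ys , eq = cauchy H ys-unique
      (λ {y} y∈ → let y∈t , fixed = ys⇒ y∈ in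
        ∈transversal⇒rep≡ y∈t ,
        record { commute = λ {h} h∈ → y ⁻¹ ∙ (h ∙ y) ,
          rep≡⇒~ (trans (∈transversal⇒rep≡ y∈t) (sym (fixed h∈))) ,
          sym (\\-leftDividesˡ y (h ∙ y)) })
      (λ {y} rep≡ n → ⇒ys (subst (_∈ transversal H) rep≡ (rep∈transversal y))
        λ {h} h∈ → let k , k∈ , hy≡yk = commute n h∈ in
          trans (cong (rep H) hy≡yk) (trans (sym (~⇒rep≡ (~-∙ʳ y k∈))) rep≡))
      (∣-remove-multiple prime eq p∣t)
      where open Subgroup H using (∈transversal⇒rep≡; rep∈transversal; rep≡⇒~; ~⇒rep≡; ~-∙ʳ)

    larger-p-group : ∀ {H} → IsPGroup prime H → p ∣ length (transversal H) →
      ∃ λ K → IsPGroup prime K × complement-size K < complement-size H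
    larger-p-group {H} pH p∣ = extended (enlarge pH p∣)
      where
      extended : (∃ λ x → ¬ Mem H x × Normalises x H × Mem H (x ^^ p)) →
        ∃ λ K → IsPGroup prime K × complement-size K < complement-size H
      extended (x , x∉ , nx , xᵖ∈) = K , extend-p pH x nx xᵖ∈ ,
        length-filter-< (¬? ∘ mem? H) (¬? ∘ mem? K)
          (λ x∉K x∈H → x∉K (0 , _ , x∈H , sym (identityˡ _)))
          (Unique.allFin⁺ m) (∈-allFin x) x∉
          (λ x∉K → x∉K (1 , ε , ε∈ H , sym (trans (identityʳ _) (identityʳ x))))
        where
        K = extend H x nx p xᵖ∈

    -- The tower grows as long as `p` divides the index. That the index is prime to `p` is the form
    -- in which transitivity will use it, so no order is computed.
    sylow : ∃ λ P → IsPGroup prime P × ¬ p ∣ length (transversal P)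
    sylow = grow trivial trivial-p (<-wellFounded _)
      where
      grow : ∀ H → IsPGroup prime H → Acc _<_ (complement-size H) →
        ∃ λ P → IsPGroup prime P × ¬ p ∣ length (transversal P)
      grow H pH (acc rs) with p ∣? length (transversal H)
      ... | no p∤ = H , pH , p∤
      ... | yes p∣ = let K , pK , smaller = larger-p-group pH p∣ in grow K pK (rs smaller)

-- Sharply transitive sets

module Centre {m} {mul : Op₂ (Fin m)} {e} {inv : Op₁ (Fin m)}
  (isGroup : IsGroup _≡_ mul e inv) where
  open FiniteGroup isGroup
  open Sylow isGroup
  open Normalises
  open Subgroup using (Mem; mem?; ε∈; ∙∈; ⁻¹∈; rep; transversal; rep-rep)

  record IsNormalIn (P M : Subgroup) : Set where
    field
      ⊆      : ∀ {x} → Mem M x → Mem P x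
      normal : ∀ {g} → Mem P g → Normalises g M

    -- The mirror image of `commute`, obtained from it for `g ⁻¹`.
    conjugate : ∀ {g h} → Mem P g → Mem M h → ∃ λ k → Mem M k × g ∙ h ≡ k ∙ g
    conjugate {g} {h} g∈ h∈ with commute (normal (⁻¹∈ P g∈)) h∈
    ... | k , k∈ , eq = k , k∈ , (begin
      g ∙ h                        ≡⟨ identityʳ (g ∙ h) ⟨
      (g ∙ h) ∙ ε                  ≡⟨ cong (g ∙ h ∙_) (inverseˡ g) ⟨
      (g ∙ h) ∙ (g ⁻¹ ∙ g)         ≡⟨ assoc g h (g ⁻¹ ∙ g) ⟩
      g ∙ (h ∙ (g ⁻¹ ∙ g))         ≡⟨ cong (g ∙_) (assoc h (g ⁻¹) g) ⟨
      g ∙ ((h ∙ g ⁻¹) ∙ g)         ≡⟨ cong (λ x → g ∙ (x ∙ g)) eq ⟩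
      g ∙ ((g ⁻¹ ∙ k) ∙ g)         ≡⟨ cong (g ∙_) (assoc (g ⁻¹) k g) ⟩
      g ∙ (g ⁻¹ ∙ (k ∙ g))         ≡⟨ \\-leftDividesˡ g (k ∙ g) ⟩
      k ∙ g                        ∎)
      where open ≡-Reasoning

    open Subgroup M using (_~_)

    ~-∙-normal : ∀ {x y g} → Mem P g → x ~ y → (x ∙ g) ~ (y ∙ g)
    ~-∙-normal {x} {y} {g} g∈ x~y with commute (normal g∈) x~y
    ... | k , k∈ , eq = subst (Mem M) (sym (begin
      (x ∙ g) ⁻¹ ∙ (y ∙ g)      ≡⟨ cong (_∙ (y ∙ g)) (⁻¹-anti-homo-∙ x g) ⟩
      (g ⁻¹ ∙ x ⁻¹) ∙ (y ∙ g)   ≡⟨ assoc (g ⁻¹) (x ⁻¹) (y ∙ g) ⟩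
      g ⁻¹ ∙ (x ⁻¹ ∙ (y ∙ g))   ≡⟨ cong (g ⁻¹ ∙_) (assoc (x ⁻¹) y g) ⟨
      g ⁻¹ ∙ ((x ⁻¹ ∙ y) ∙ g)   ≡⟨ cong (g ⁻¹ ∙_) eq ⟩
      g ⁻¹ ∙ (g ∙ k)            ≡⟨ \\-leftDividesʳ g k ⟩
      k                         ∎)) k∈
      where open ≡-Reasoning

  -- The preimage in P of the centre of P/M.
  module _ {P M : Subgroup} (M◁P : IsNormalIn P M) where
    open IsNormalIn M◁P
    open Subgroup M using (_~_; ~-refl; ~-sym; ~-trans; ~-∙ˡ; ~-∙ʳ; rep-~; ~⇒rep≡; rep≡⇒~;
      rep∈transversal; ∈transversal⇒rep≡; transversal-unique; rep≡ε⇒Mem; Mem⇒rep≡ε)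

    centre : Subgroup
    centre = record
      { Mem  = λ z → Mem P z × (∀ g → Mem P g → (g ∙ z) ~ (z ∙ g))
      ; mem? = λ z → mem? P z ×-dec all? λ g → mem? P g →-dec mem? M ((g ∙ z) ⁻¹ ∙ (z ∙ g))
      ; ε∈   = ε∈ P , λ g _ → subst (_~ (ε ∙ g)) (trans (identityˡ g) (sym (identityʳ g))) ~-refl
      ; ∙∈   = λ {y} {z} (y∈ , yc) (z∈ , zc) → ∙∈ P y∈ z∈ , λ g g∈ →
          subst₂ _~_ (assoc g y z) (sym (assoc y z g))
            (~-trans (~-∙-normal z∈ (yc g g∈))
              (subst (_~ (y ∙ (z ∙ g))) (sym (assoc y g z)) (~-∙ˡ y (zc g g∈))))
      }

    M⊆centre : ∀ {x} → Mem M x → Mem centre x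
    M⊆centre {x} x∈ = ⊆ x∈ , λ g g∈ → let k , k∈ , eq = commute (normal g∈) x∈ in
      ~-trans (~-sym (~-∙ʳ g x∈)) (subst (g ~_) (sym eq) (~-∙ʳ g k∈))

    -- A conjugate of `z` differs from `z` by an element of `M`, and `M` is contained in the
    -- centre's preimage.
    centre-normal : IsNormalIn P centre
    centre-normal = record
      { ⊆ = proj₁
      ; normal = λ {g} g∈ → record { commute = λ {z} z∈ →
          let k = g ⁻¹ ∙ (z ∙ g)
              z~k : z ~ k
              z~k = subst (_~ k) (\\-leftDividesʳ g z) (~-∙ˡ (g ⁻¹) (proj₂ z∈ g g∈))
          in k , subst (Mem centre) (\\-leftDividesˡ z k) (∙∈ centre z∈ (M⊆centre z~k)) ,
             sym (\\-leftDividesˡ g (z ∙ g)) }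
      }

    module _ {p} (prime : Prime p) (pP : IsPGroup prime P) {w} (w∈P : Mem P w) (w∉M : ¬ Mem M w) where
      private
        cosets = filter (mem? P) (transversal M)

        cosets⇒ : ∀ {y} → y ∈ cosets → Mem P y × rep M y ≡ y
        cosets⇒ y∈ = let y∈t , y∈P = ∈-filter⁻ (mem? P) {xs = transversal M} y∈ in y∈P , ∈transversal⇒rep≡ y∈t

        P-resp : ∀ {x y} → x ~ y → Mem P x → Mem P y
        P-resp {x} {y} x~y x∈ = subst (Mem P) (\\-leftDividesˡ x y) (∙∈ P x∈ (⊆ x~y))

        ⇒cosets : ∀ {y} → Mem P y → rep M y ∈ cosets
        ⇒cosets {y} y∈ = ∈-filter⁺ (mem? P) (rep∈transversal y) (P-resp (rep-~ y) y∈)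

        cosets-unique : Unique cosets
        cosets-unique = Unique.filter⁺ (mem? P) transversal-unique

      -- Left multiplication by `P` on the cosets of `M` in `P` has no fixed point: if the coset of
      -- `y` were fixed, the conjugate of `w` by `y` would put `y ∙ w` into it, and `w` into `M`.
      p∣index : p ∣ length cosets
      p∣index with fixed-points prime pP _≟_ (λ g y → rep M (g ∙ y)) cosets-unique (record
        { closed = λ g∈ y∈ → ⇒cosets (∙∈ P g∈ (proj₁ (cosets⇒ y∈)))
        ; act-ε  = λ {y} y∈ → trans (cong (rep M) (identityˡ y)) (proj₂ (cosets⇒ y∈))
        ; act-∙  = λ {g} {h} {y} _ _ _ → trans (cong (rep M) (assoc g h y)) (~⇒rep≡ (~-∙ˡ g (rep-~ (h ∙ y))))
        })
      ... | [] , _ , _ , _ , c , eq = divides c eq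
      ... | y ∷ _ , _ , ys⇒ , _ with ys⇒ (here refl)
      ...   | y∈ , fixed = contradiction (subst (Mem M) (\\-leftDividesʳ y w) y~yw) w∉M
        where
        y∈P = proj₁ (cosets⇒ y∈)
        g = (y ∙ w) ∙ y ⁻¹
        gy≡yw : g ∙ y ≡ y ∙ w
        gy≡yw = trans (assoc (y ∙ w) (y ⁻¹) y) (trans (cong (y ∙ w ∙_) (inverseˡ y)) (identityʳ _))
        y~yw : y ~ (y ∙ w)
        y~yw = rep≡⇒~ (trans (proj₂ (cosets⇒ y∈)) (trans (sym (fixed (∙∈ P (∙∈ P y∈P w∈P) (⁻¹∈ P y∈P)))) (cong (rep M) gy≡yw)))

      -- The class equation of `P/M`: under conjugation the fixed cosets are the central ones, their
      -- number is divisible by `p`, and the coset of `ε` is among them.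
      centre-grows : ∃ λ z → Mem centre z × ¬ Mem M z
      centre-grows with fixed-points prime pP _≟_ (λ g y → rep M ((g ∙ y) ∙ g ⁻¹)) cosets-unique (record
        { closed = λ g∈ y∈ → ⇒cosets (∙∈ P (∙∈ P g∈ (proj₁ (cosets⇒ y∈))) (⁻¹∈ P g∈))
        ; act-ε  = λ {y} y∈ → trans (cong (rep M)
            (trans (cong₂ _∙_ (identityˡ y) ε⁻¹≈ε) (identityʳ y))) (proj₂ (cosets⇒ y∈))
        ; act-∙  = λ {g} {h} {y} g∈ h∈ _ → trans (cong (rep M) (conj-∙ g h y))
            (~⇒rep≡ (~-∙-normal (⁻¹∈ P g∈) (~-∙ˡ g (rep-~ ((h ∙ y) ∙ h ⁻¹)))))
        })
        where
        open ≡-Reasoning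
        conj-∙ : ∀ g h y → ((g ∙ h) ∙ y) ∙ (g ∙ h) ⁻¹ ≡ (g ∙ ((h ∙ y) ∙ h ⁻¹)) ∙ g ⁻¹
        conj-∙ g h y = begin
          ((g ∙ h) ∙ y) ∙ (g ∙ h) ⁻¹       ≡⟨ cong₂ _∙_ (assoc g h y) (⁻¹-anti-homo-∙ g h) ⟩
          (g ∙ (h ∙ y)) ∙ (h ⁻¹ ∙ g ⁻¹)    ≡⟨ assoc (g ∙ (h ∙ y)) (h ⁻¹) (g ⁻¹) ⟨
          ((g ∙ (h ∙ y)) ∙ h ⁻¹) ∙ g ⁻¹    ≡⟨ cong (_∙ g ⁻¹) (assoc g (h ∙ y) (h ⁻¹)) ⟩
          (g ∙ ((h ∙ y) ∙ h ⁻¹)) ∙ g ⁻¹    ∎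
      ... | ys , ys-unique , ys⇒ , ⇒ys , eq =
        central (another-element prime ys-unique (∣-remove-multiple prime eq p∣index) r∈)
        where
        r = rep M ε
        r∈M : Mem M r
        r∈M = rep≡ε⇒Mem (rep-rep M ε)
        right : ∀ g x → (x ∙ g ⁻¹) ∙ g ≡ x
        right g x = trans (assoc x (g ⁻¹) g) (trans (cong (x ∙_) (inverseˡ g)) (identityʳ x))
        r∈ : r ∈ ys
        r∈ = ⇒ys (⇒cosets (ε∈ P)) λ {g} g∈ → let k , k∈ , eq = conjugate g∈ r∈M in
          Mem⇒rep≡ε (subst (Mem M) (sym (trans (cong (_∙ g ⁻¹) eq)
            (trans (assoc k g (g ⁻¹)) (trans (cong (k ∙_) (inverseʳ g)) (identityʳ k))))) k∈)
        central : (∃ λ y → y ∈ ys × y ≢ r) → ∃ λ z → Mem centre z × ¬ Mem M z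
        central (y , y∈ , y≢r) = y , (y∈P , λ g g∈ →
            subst (_~ (y ∙ g)) (right g (g ∙ y))
              (~-∙-normal g∈ (rep≡⇒~ (trans (proj₂ (ys⇒ y∈) g∈) (sym rep≡)))))
          , λ y∈M → y≢r (trans (sym rep≡) (Mem⇒rep≡ε y∈M))
          where
          y∈P = proj₁ (cosets⇒ (proj₁ (ys⇒ y∈)))
          rep≡ = proj₂ (cosets⇒ (proj₁ (ys⇒ y∈)))

-- Orbits and the refinement of sharply transitive sets

module Action {m} {mul : Op₂ (Fin m)} {e} {inv : Op₁ (Fin m)}
  (isGroup : IsGroup _≡_ mul e inv) {n} (act : Fin m → Fin n → Fin n)
  (act-ε : ∀ α → act e α ≡ α) (act-∙ : ∀ g h α → act (mul g h) α ≡ act g (act h α)) where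
  open FiniteGroup isGroup
  open Sylow isGroup
  open Centre isGroup
  open Subgroup using (Mem; mem?; ε∈; ∙∈; ⁻¹∈; rep; transversal; elements)
  open ≡-Reasoning

  act-⁻¹ˡ : ∀ g α → act (g ⁻¹) (act g α) ≡ α
  act-⁻¹ˡ g α = trans (sym (act-∙ (g ⁻¹) g α)) (trans (cong (λ x → act x α) (inverseˡ g)) (act-ε α))

  act-⁻¹ʳ : ∀ g α → act g (act (g ⁻¹) α) ≡ α
  act-⁻¹ʳ g α = trans (sym (act-∙ g (g ⁻¹) α)) (trans (cong (λ x → act x α) (inverseʳ g)) (act-ε α))

  Transitive : Subgroup → Set
  Transitive P = ∀ α β → ∃ λ g → Mem P g × act g α ≡ β

  module Orbits (M : Subgroup) where
    infix 4 _≈_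
    _≈_ : Fin n → Fin n → Set
    α ≈ β = ∃ λ h → Mem M h × act h α ≡ β

    ≈-dec : ∀ α β → Dec (α ≈ β)
    ≈-dec α β = any? λ h → mem? M h ×-dec act h α ≟ β

    ≈-refl : ∀ {α} → α ≈ α
    ≈-refl = ε , ε∈ M , act-ε _

    ≈-sym : ∀ {α β} → α ≈ β → β ≈ α
    ≈-sym (h , h∈ , refl) = h ⁻¹ , ⁻¹∈ M h∈ , act-⁻¹ˡ h _

    ≈-trans : ∀ {α β γ} → α ≈ β → β ≈ γ → α ≈ γ
    ≈-trans (h , h∈ , refl) (k , k∈ , refl) = k ∙ h , ∙∈ M k∈ h∈ , act-∙ k h _

  record SharplyTransitiveModulo (P M : Subgroup) (T : List (Fin m)) : Set where
    open Orbits M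
    field
      reaches : ∀ α β → ∃ λ t → t ∈ T × act t α ≈ β
      sharp   : ∀ {s t} → s ∈ T → t ∈ T → ∀ {α} → act s α ≈ act t α → s ≡ t

  module _ {P : Subgroup} (P-transitive : Transitive P) {M : Subgroup} (M◁P : IsNormalIn P M) where
    open IsNormalIn M◁P
    open Orbits M
    private Z = centre M◁P
    module Zᵒ = Orbits Z

    equivariant : ∀ {g α β} → Mem P g → α ≈ β → act g α ≈ act g β
    equivariant {g} {α} g∈ (h , h∈ , refl) = let k , k∈ , eq = conjugate g∈ h∈ in k , k∈ , (begin
      act k (act g α) ≡⟨ act-∙ k g α ⟨
      act (k ∙ g) α   ≡⟨ cong (λ x → act x α) eq ⟨
      act (g ∙ h) α   ≡⟨ act-∙ g h α ⟩
      act g (act h α) ∎)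

    kernel : Subgroup
    kernel = record
      { Mem  = λ z → Mem Z z × (∀ α → act z α ≈ α)
      ; mem? = λ z → mem? Z z ×-dec all? λ α → ≈-dec (act z α) α
      ; ε∈   = ε∈ Z , λ α → subst (_≈ α) (sym (act-ε α)) ≈-refl
      ; ∙∈   = λ {y} {z} (y∈ , ky) (z∈ , kz) → ∙∈ Z y∈ z∈ , λ α →
          subst (_≈ α) (sym (act-∙ y z α)) (≈-trans (ky (act z α)) (kz α))
      }

    -- Write `β` as `act g α`. Modulo `M`, `z` commutes with `g`, so it sends `β` into the orbit of
    -- `act g (act z α)`, which is the orbit of `act g α`.
    central-fixes-all : ∀ {z α} → Mem Z z → act z α ≈ α → ∀ β → act z β ≈ β
    central-fixes-all {z} {α} (z∈P , zc) zα≈α β with P-transitive α β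
    ... | g , g∈ , refl = subst (_≈ act g α) (sym eq) (equivariant g∈
        (≈-trans (equivariant z∈P (≈-sym (c , zc g g∈ , refl))) zα≈α))
      where
      c = (g ∙ z) ⁻¹ ∙ (z ∙ g)
      eq : act z (act g α) ≡ act g (act z (act c α))
      eq = begin
        act z (act g α)         ≡⟨ act-∙ z g α ⟨
        act (z ∙ g) α           ≡⟨ cong (λ x → act x α) (\\-leftDividesˡ (g ∙ z) (z ∙ g)) ⟨
        act ((g ∙ z) ∙ c) α     ≡⟨ act-∙ (g ∙ z) c α ⟩
        act (g ∙ z) (act c α)   ≡⟨ act-∙ g z (act c α) ⟩
        act g (act z (act c α)) ∎

    module _ {T} (T-sharp : SharplyTransitiveModulo P Z T) where
      open SharplyTransitiveModulo T-sharp
      open Subgroup kernel using (rep-~; rep∈transversal; ∈transversal⇒rep≡; ~⇒rep≡)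

      lifts : List (Fin m)
      lifts = filter (mem? Z) (transversal kernel)

      -- To reach `β`, let `T` reach its `Z`-orbit and correct by some `z` in `Z`; the
      -- representative of `z` differs from it by a kernel element, which preserves every `M`-orbit.
      -- For sharpness, the `Z`-orbits determine the factor from `T`, and then the kernel class
      -- determines the lift.
      refine : SharplyTransitiveModulo P M (cartesianProductWith _∙_ lifts T)
      refine = record { reaches = reaches′ ; sharp = sharp′ }
        where
        reaches′ : ∀ α β → ∃ λ t → t ∈ cartesianProductWith _∙_ lifts T × act t α ≈ β
        reaches′ α β with reaches α β
        ... | t , t∈ , z , z∈ , refl = s ∙ t , ∈-cartesianProductWith⁺ _∙_ s∈ t∈ ,
            subst₂ _≈_ (sym eq) refl (equivariant (proj₁ z∈) (proj₂ (rep-~ z) (act t α)))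
          where
          s = rep kernel z
          c = z ⁻¹ ∙ s
          s∈ : s ∈ lifts
          s∈ = ∈-filter⁺ (mem? Z) (rep∈transversal z)
            (subst (Mem Z) (\\-leftDividesˡ z s) (∙∈ Z z∈ (proj₁ (rep-~ z))))
          eq : act (s ∙ t) α ≡ act z (act c (act t α))
          eq = begin
            act (s ∙ t) α             ≡⟨ act-∙ s t α ⟩
            act s (act t α)           ≡⟨ cong (λ x → act x (act t α)) (\\-leftDividesˡ z s) ⟨
            act (z ∙ c) (act t α)     ≡⟨ act-∙ z c (act t α) ⟩
            act z (act c (act t α))   ∎

        sharp″ : ∀ {s s′ t t′ α} → s ∈ lifts → s′ ∈ lifts → t ∈ T → t′ ∈ T →
          act s (act t α) ≈ act s′ (act t′ α) → s ∙ t ≡ s′ ∙ t′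
        sharp″ {s} {s′} {t} {t′} {α} s∈ s′∈ t∈ t′∈ sim@(h , h∈ , eq)
          with ∈-filter⁻ (mem? Z) {xs = transversal kernel} s∈ | ∈-filter⁻ (mem? Z) {xs = transversal kernel} s′∈
        ... | s∈t , s∈Z | s′∈t , s′∈Z with sharp t∈ t′∈ {α} (Zᵒ.≈-trans (s , s∈Z , refl)
              (Zᵒ.≈-trans (h , M⊆centre M◁P h∈ , eq) (Zᵒ.≈-sym (s′ , s′∈Z , refl))))
        ...   | refl = cong (_∙ t) (trans (sym (∈transversal⇒rep≡ s∈t))
                  (trans (~⇒rep≡ s~s′) (∈transversal⇒rep≡ s′∈t)))
          where
          γ = act t α
          -- Once `t` and `t′` coincide, `s ⁻¹ ∙ s′` preserves the `M`-orbit of the single point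
          -- `γ`; being central modulo `M`, it preserves all of them.
          s~s′ : Subgroup._~_ kernel s s′
          s~s′ = ∙∈ Z (⁻¹∈ Z s∈Z) s′∈Z , central-fixes-all (∙∈ Z (⁻¹∈ Z s∈Z) s′∈Z)
            (subst₂ _≈_ (sym (act-∙ (s ⁻¹) s′ γ)) (act-⁻¹ˡ s γ)
              (equivariant (⁻¹∈ P (proj₁ s∈Z)) (≈-sym sim)))

        sharp′ : ∀ {x y} → x ∈ cartesianProductWith _∙_ lifts T → y ∈ cartesianProductWith _∙_ lifts T →
          ∀ {α} → act x α ≈ act y α → x ≡ y
        sharp′ x∈ y∈ {α} sim with ∈-cartesianProductWith⁻ _∙_ lifts T x∈ | ∈-cartesianProductWith⁻ _∙_ lifts T y∈
        ... | s , t , s∈ , t∈ , refl | s′ , t′ , s′∈ , t′∈ , refl =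
          sharp″ s∈ s′∈ t∈ t′∈ (subst₂ _≈_ (act-∙ s t α) (act-∙ s′ t′ α) sim)

  module _ {p} (prime : Prime p) {P} (pP : IsPGroup prime P) (P-transitive : Transitive P) where

    sharply-transitive-modulo : ∀ M → IsNormalIn P M → Acc _<_ (complement-size M) →
      ∃ (SharplyTransitiveModulo P M)
    sharply-transitive-modulo M M◁P (acc rs) with any? (λ w → mem? P w ×-dec ¬? (mem? M w))
    ... | yes (w , w∈P , w∉M) =
      let z , z∈ , z∉M = centre-grows M◁P prime pP w∈P w∉M
          T , T-sharp = sharply-transitive-modulo (centre M◁P) (centre-normal M◁P)
            (rs (length-filter-< (¬? ∘ mem? M) (¬? ∘ mem? (centre M◁P)) (λ x∉ x∈ → x∉ (M⊆centre M◁P x∈))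
              (Unique.allFin⁺ m) (∈-allFin z) z∉M (λ z∉ → z∉ z∈)))
      in _ , refine P-transitive M◁P T-sharp
    -- `M` now contains `P`, so there is only one `M`-orbit and one element is sharply transitive on
    -- it.
    ... | no P⊆M = [ ε ] , record
      { reaches = λ α β → let g , g∈ , eq = P-transitive α β in ε , here refl , g , P⇒M g∈ ,
          trans (cong (act g) (act-ε α)) eq
      ; sharp   = λ { (here refl) (here refl) _ → refl }
      }
      where
      P⇒M : ∀ {g} → Mem P g → Mem M g
      P⇒M {g} g∈ with mem? M g
      ... | yes g∈M = g∈M
      ... | no  g∉M = contradiction (g , g∈ , g∉M) P⊆M

    sharply-transitive-set : ∃ λ T → (∀ α β → ∃ λ t → t ∈ T × act t α ≡ β) ×
      (∀ {s t} → s ∈ T → t ∈ T → ∀ {α} → act s α ≡ act t α → s ≡ t)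
    sharply-transitive-set with sharply-transitive-modulo trivial (record
        { ⊆ = λ { refl → ε∈ P }
        ; normal = λ {g} _ → record { commute = λ { refl → ε , refl , trans (identityˡ g) (sym (identityʳ g)) } }
        }) (<-wellFounded _)
    ... | T , T-sharp = T ,
        (λ α β → let t , t∈ , h , h≡ε , eq = reaches α β in t , t∈ ,
           trans (sym (trans (cong (λ x → act x (act t α)) h≡ε) (act-ε (act t α)))) eq) ,
        (λ s∈ t∈ {α} eq → sharp s∈ t∈ {α} (ε , refl , trans (act-ε _) eq))
      where open SharplyTransitiveModulo T-sharp

  -- The clique-coclique bound.
  intersecting-*-sharp : ∀ {xs ts} → Unique xs → Unique ts →
    (∀ {x y} → x ∈ xs → y ∈ xs → ∃ λ α → act x α ≡ act y α) →
    (∀ {s t} → s ∈ ts → t ∈ ts → ∀ {α} → act s α ≡ act t α → s ≡ t) →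
    length xs * length ts ≤ m
  intersecting-*-sharp {xs} {ts} xs-unique ts-unique intersect sharp =
    subst₂ _≤_ (length-cartesianProductWith _,_ xs ts) (length-allFin m)
      (length-≤-injection (λ (x , t) → t ⁻¹ ∙ x) (Unique.cartesianProduct⁺ xs-unique ts-unique)
        injective (λ _ → ∈-allFin _))
    where
    injective : ∀ {u v} → u ∈ cartesianProduct xs ts → v ∈ cartesianProduct xs ts →
      proj₂ u ⁻¹ ∙ proj₁ u ≡ proj₂ v ⁻¹ ∙ proj₁ v → u ≡ v
    injective {x , t} {y , u} xt∈ yu∈ eq with ∈-cartesianProduct⁻ xs ts xt∈ | ∈-cartesianProduct⁻ xs ts yu∈
    ... | x∈ , t∈ | y∈ , u∈ with intersect x∈ y∈
    -- Let `g` be the common value of the two quotients. Then `t ∙ g` is `x` and `u ∙ g` is `y`; as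
    -- these agree at `α`, the elements `t` and `u` agree at `act g α`.
    ...   | α , xα≡yα with sharp t∈ u∈ {act (t ⁻¹ ∙ x) α} (begin
            act t (act (t ⁻¹ ∙ x) α)   ≡⟨ act-∙ t (t ⁻¹ ∙ x) α ⟨
            act (t ∙ (t ⁻¹ ∙ x)) α     ≡⟨ cong (λ g → act g α) (\\-leftDividesˡ t x) ⟩
            act x α                    ≡⟨ xα≡yα ⟩
            act y α                    ≡⟨ cong (λ g → act g α) (\\-leftDividesˡ u y) ⟨
            act (u ∙ (u ⁻¹ ∙ y)) α     ≡⟨ act-∙ u (u ⁻¹ ∙ y) α ⟩
            act u (act (u ⁻¹ ∙ y) α)   ≡⟨ cong (λ g → act u (act g α)) eq ⟨
            act u (act (t ⁻¹ ∙ x) α)   ∎)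
    ...     | refl = cong (_, t) (∙-cancelˡ (t ⁻¹) x y eq)

  -- Orbit counting and transitivity of Sylow subgroups

  module _ (transitive : ∀ α β → ∃ λ g → act g α ≡ β) (ω : Fin n) where

    stabiliser : List (Fin m)
    stabiliser = filter (λ g → act g ω ≟ ω) (allFin m)

    -- The fibres of `g ↦ act (g ⁻¹) ω` are right cosets of the stabiliser. The inverse is taken so
    -- that, for `B` an orbit of a subgroup, the preimage is a union of left cosets of that
    -- subgroup.
    length-preimage : ∀ {B : Pred (Fin n) 0ℓ} (B? : Decidable B) →
      length (filter (λ g → B? (act (g ⁻¹) ω)) (allFin m)) ≡
        length (filter B? (allFin n)) * length stabiliser
    length-preimage {B} B? = length-fibres _≟_ (λ g → act (g ⁻¹) ω) (length stabiliser)
      (filter B′? (allFin m)) (Unique.filter⁺ B? (Unique.allFin⁺ n))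
      (λ g∈ → ∈-filter⁺ B? (∈-allFin _) (proj₂ (∈-filter⁻ B′? {xs = allFin m} g∈)))
      (λ β∈ → size (proj₂ (∈-filter⁻ B? {xs = allFin n} β∈)))
      where
      B′? = λ g → B? (act (g ⁻¹) ω)
      stab? = λ g → act g ω ≟ ω
      size : ∀ {β} → B β → length (filter (λ g → act (g ⁻¹) ω ≟ β) (filter B′? (allFin m))) ≡ length stabiliser
      size {β} Bβ with transitive β ω
      ... | g₀ , refl = ≤-antisym
        (length-≤-injection (_∙ g₀ ⁻¹) (Unique.filter⁺ fib? (Unique.filter⁺ B′? (Unique.allFin⁺ m)))
          (λ _ _ → ∙-cancelʳ (g₀ ⁻¹) _ _)
          (λ {g} g∈ → ∈-filter⁺ stab? (∈-allFin _) (begin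
            act (g ∙ g₀ ⁻¹) (act g₀ β)          ≡⟨ act-∙ g (g₀ ⁻¹) (act g₀ β) ⟩
            act g (act (g₀ ⁻¹) (act g₀ β))      ≡⟨ cong (act g) (act-⁻¹ˡ g₀ β) ⟩
            act g β                             ≡⟨ cong (act g) (proj₂ (∈-filter⁻ fib? {xs = filter B′? (allFin m)} g∈)) ⟨
            act g (act (g ⁻¹) (act g₀ β))       ≡⟨ act-⁻¹ʳ g (act g₀ β) ⟩
            act g₀ β                            ∎)))
        (length-≤-injection (_∙ g₀) (Unique.filter⁺ stab? (Unique.allFin⁺ m))
          (λ _ _ → ∙-cancelʳ g₀ _ _)
          (λ {s} s∈ → let
              sω≡ω = proj₂ (∈-filter⁻ stab? {xs = allFin m} s∈)
              eq : act ((s ∙ g₀) ⁻¹) (act g₀ β) ≡ β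
              eq = begin
                act ((s ∙ g₀) ⁻¹) (act g₀ β)           ≡⟨ cong (act ((s ∙ g₀) ⁻¹)) sω≡ω ⟨
                act ((s ∙ g₀) ⁻¹) (act s (act g₀ β))   ≡⟨ cong (act ((s ∙ g₀) ⁻¹)) (act-∙ s g₀ β) ⟨
                act ((s ∙ g₀) ⁻¹) (act (s ∙ g₀) β)     ≡⟨ act-⁻¹ˡ (s ∙ g₀) β ⟩
                β                                      ∎
            in ∈-filter⁺ fib? (∈-filter⁺ B′? (∈-allFin _) (subst B (sym eq) Bβ)) eq))
        where fib? = λ g → act (g ⁻¹) ω ≟ β

    order : m ≡ n * length stabiliser
    order = begin
      m                                                            ≡⟨ length-allFin m ⟨
      length (allFin m)                                            ≡⟨ cong length (filter-all U? (All.universal _ (allFin m))) ⟨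
      length (filter (λ g → U? (act (g ⁻¹) ω)) (allFin m))         ≡⟨ length-preimage U? ⟩
      length (filter U? (allFin n)) * length stabiliser            ≡⟨ cong (λ xs → length xs * length stabiliser) (filter-all U? (All.universal _ (allFin n))) ⟩
      length (allFin n) * length stabiliser                        ≡⟨ cong (_* length stabiliser) (length-allFin n) ⟩
      n * length stabiliser                                        ∎

    module _ {p} (prime : Prime p) (k : ℕ) (n≡pᵏ : n ≡ p ^ k) where

      private
        s = length stabiliser
        instance
          s≢0 : NonZero s
          s≢0 = ∈⇒length≢0 (∈-filter⁺ (λ g → act g ω ≟ ω) (∈-allFin ε) (act-ε ω))

      module _ (P : Subgroup) (p∤index : ¬ p ∣ length (transversal P)) where
        open Orbits P
        private
          o = length (filter (≈-dec ω) (allFin n))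
          r = length (transversal P)
          q = length (elements P)
          A? = λ g → ≈-dec ω (act (g ⁻¹) ω)
          c = length (filter A? (transversal P))

          -- Both sides count the elements whose inverses send `ω` into its own `P`-orbit: once by
          -- the image of `ω`, once by left cosets of `P`.
          o*s≡c*q : o * s ≡ c * q
          o*s≡c*q = trans (sym (length-preimage (≈-dec ω))) (Subgroup.length-union-of-cosets P A?
            λ {x} {h} ω≈ h∈ → ≈-trans ω≈ (h ⁻¹ , ⁻¹∈ P h∈ ,
              trans (sym (act-∙ (h ⁻¹) (x ⁻¹) ω)) (cong (λ y → act y ω) (sym (⁻¹-anti-homo-∙ x h)))))

          m≡r*q : m ≡ r * q
          m≡r*q = begin
            m                             ≡⟨ length-allFin m ⟨
            length (allFin m)             ≡⟨ cong length (filter-all U? (All.universal _ (allFin m))) ⟨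
            length (filter U? (allFin m)) ≡⟨ Subgroup.length-union-of-cosets P U? (λ _ _ → _) ⟩
            length (filter U? (transversal P)) * q ≡⟨ cong (λ xs → length xs * q) (filter-all U? (All.universal _ (transversal P))) ⟩
            r * q                         ∎

          -- The order of `P` is eliminated through `r * q ≡ m ≡ n * s`, after which the positive
          -- factor `s` cancels.
          o*r≡c*n : o * r ≡ c * n
          o*r≡c*n = *-cancelʳ-≡ (o * r) (c * n) s (begin
            o * r * s    ≡⟨ *-assoc o r s ⟩
            o * (r * s)  ≡⟨ cong (o *_) (*-comm r s) ⟩
            o * (s * r)  ≡⟨ *-assoc o s r ⟨
            o * s * r    ≡⟨ cong (_* r) o*s≡c*q ⟩
            c * q * r    ≡⟨ *-assoc c q r ⟩
            c * (q * r)  ≡⟨ cong (c *_) (trans (*-comm q r) (trans (sym m≡r*q) order)) ⟩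
            c * (n * s)  ≡⟨ *-assoc c n s ⟨
            c * n * s    ∎)

          -- The prime power `n` divides `o * r`, and `r` is prime to `p`; hence `n` divides `o`,
          -- which is positive because the orbit contains `ω`.
          n≤o : n ≤ o
          n≤o = ∣⇒≤ {{∈⇒length≢0 (∈-filter⁺ (≈-dec ω) (∈-allFin ω) ≈-refl)}}
            (subst (_∣ o) (sym n≡pᵏ) (^-∣-coprime prime k o p∤index
              (divides c (trans o*r≡c*n (cong (c *_) n≡pᵏ)))))

          ω≈ : ∀ β → ω ≈ β
          ω≈ β with ≈-dec ω β
          ... | yes ω≈β = ω≈β
          ... | no ω≉β = contradiction n≤o (<⇒≱ (<-≤-trans
            (length-filter-< U? (≈-dec ω) _ (Unique.allFin⁺ n) (∈-allFin β) _ ω≉β)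
            (≤-trans (length-filter U? (allFin n)) (≤-reflexive (length-allFin n)))))

        p∤index⇒transitive : Transitive P
        p∤index⇒transitive α β = ≈-trans (≈-sym (ω≈ α)) (ω≈ β)

      intersecting-bound : ∀ {xs} → Unique xs →
        (∀ {x y} → x ∈ xs → y ∈ xs → ∃ λ α → act x α ≡ act y α) → length xs ≤ s
      intersecting-bound {xs} uniq intersect with sylow prime
      ... | P , pP , p∤index with sharply-transitive-set prime pP (p∤index⇒transitive P p∤index)
      ...   | T , reaches , sharp = *-cancelˡ-≤ n {{nonZeroIndex ω}}
        (subst₂ _≤_ (*-comm (length xs) n) order
          (≤-trans (*-monoʳ-≤ (length xs) n≤T′)
            (intersecting-*-sharp uniq (DecUnique.deduplicate-! _≟_ T) intersect
              (λ s∈ t∈ → sharp (∈-deduplicate⁻ _≟_ T s∈) (∈-deduplicate⁻ _≟_ T t∈)))))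
        where
        -- `T` may list an element repeatedly, and the clique-coclique bound counts distinct ones.
        -- There are at least `n` of them, since their images of `ω` cover all points.
        T′ = deduplicate _≟_ T
        n≤T′ : n ≤ length T′
        n≤T′ = subst₂ _≤_ (length-allFin n) (length-map (λ t → act t ω) T′)
          (length-≤-⊆ (Unique.allFin⁺ n) λ {β} _ → let t , t∈ , eq = reaches ω β in
            subst (_∈ map (λ t → act t ω) T′) eq (∈-map⁺ (λ t → act t ω) (∈-deduplicate⁺ _≟_ t∈)))

-- Permutation groups

lookup-injective-≈ : ∀ {n} {G : List (Permutation′ n)} → DistinctPerms G →
  ∀ i j → lookup G i Perm.≈ lookup G j → i ≡ j
lookup-injective-≈ (_ ∷ _)  zero    zero    _  = refl
lookup-injective-≈ (g≉ ∷ _) zero    (suc j) eq = contradiction eq (All.lookup g≉ (∈-lookup j))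
lookup-injective-≈ (g≉ ∷ _) (suc i) zero    eq = contradiction (sym ∘ eq) (All.lookup g≉ (∈-lookup i))
lookup-injective-≈ (_ ∷ d)  (suc i) (suc j) eq = cong suc (lookup-injective-≈ d i j eq)

-- The group structure on the positions in the list G. Composition is reversed, so that act is a left action.
module PermGroup {n} {G : List (Permutation′ n)} (isPermGroup : IsPermGroup G) where
  open IsPermGroup isPermGroup

  Position : Set
  Position = Fin (length G)

  act : Position → Fin n → Fin n
  act i α = lookup G i ⟨$⟩ʳ α

  position : ∀ x → x ∈ₚ G → Position
  position _ (_ , g∈ , _) = index g∈

  act-position : ∀ x (x∈ : x ∈ₚ G) α → act (position x x∈) α ≡ x ⟨$⟩ʳ α
  act-position x (_ , g∈ , x≈g) α = trans (cong (_⟨$⟩ʳ α) (sym (lookup-index g∈))) (sym (x≈g α))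

  faithful : ∀ {i j} → (∀ α → act i α ≡ act j α) → i ≡ j
  faithful {i} {j} = lookup-injective-≈ distinct i j

  mul : Position → Position → Position
  mul i j = position (lookup G j Perm.∘ₚ lookup G i) (closed-∘ (∈-lookup j) (∈-lookup i))

  unit : Position
  unit = position Perm.id has-id

  inv : Position → Position
  inv i = position (flip (lookup G i)) (closed-⁻¹ (∈-lookup i))

  act-mul : ∀ i j α → act (mul i j) α ≡ act i (act j α)
  act-mul i j = act-position (lookup G j Perm.∘ₚ lookup G i) (closed-∘ (∈-lookup j) (∈-lookup i))

  act-unit : ∀ α → act unit α ≡ α
  act-unit = act-position Perm.id has-id

  act-inv : ∀ i α → act (inv i) α ≡ lookup G i ⟨$⟩ˡ α
  act-inv i = act-position (flip (lookup G i)) (closed-⁻¹ (∈-lookup i))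

  isGroup : IsGroup _≡_ mul unit inv
  isGroup = record
    { isMonoid = record
      { isSemigroup = record
        { isMagma = record { isEquivalence = isEquivalence ; ∙-cong = cong₂ mul }
        ; assoc   = λ i j k → faithful λ α → trans
            (trans (act-mul (mul i j) k α) (act-mul i j (act k α)))
            (sym (trans (act-mul i (mul j k) α) (cong (act i) (act-mul j k α))))
        }
      ; identity = (λ i → faithful λ α → trans (act-mul unit i α) (act-unit (act i α)))
                 , (λ i → faithful λ α → trans (act-mul i unit α) (cong (act i) (act-unit α)))
      }
    ; inverse = (λ i → faithful λ α → trans (act-mul (inv i) i α)
                  (trans (act-inv i (act i α)) (trans (Perm.inverseˡ (lookup G i)) (sym (act-unit α)))))
              , (λ i → faithful λ α → trans (act-mul i (inv i) α)
                  (trans (cong (act i) (act-inv i α)) (trans (Perm.inverseʳ (lookup G i)) (sym (act-unit α)))))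
    ; ⁻¹-cong = cong inv
    }

  transitive : IsTransitive G → ∀ α β → ∃ λ i → act i α ≡ β
  transitive tr α β = let g , g∈ , eq = tr α β in
    index g∈ , trans (cong (_⟨$⟩ʳ α) (sym (lookup-index g∈))) eq

  positions : ∀ {S} → DistinctPerms S → (∀ {x} → x ∈ S → x ∈ₚ G) →
    ∃ λ is → Unique is × length S ≡ length is × (∀ {i} → i ∈ is → ∃ λ x → x ∈ S × (∀ α → act i α ≡ x ⟨$⟩ʳ α))
  positions {[]} [] _ = [] , [] , refl , λ ()
  positions {x ∷ _} (x≉ ∷ d) S⊆G with positions d (S⊆G ∘ there)
  ... | is , uniq , len , is⇒ =
    position x x∈ ∷ is ,
    All.tabulate (λ { i∈ refl → let y , y∈ , eq = is⇒ i∈ in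
      All.lookup x≉ y∈ λ α → trans (sym (act-position x x∈ α)) (eq α) }) ∷ uniq ,
    cong suc len ,
    λ { (here refl) → _ , here refl , act-position x x∈
      ; (there i∈)  → let y , y∈ , eq = is⇒ i∈ in y , there y∈ , eq }
    where x∈ = S⊆G (here refl)

  length-stabiliser : ∀ ω → length (filter (λ i → act i ω ≟ ω) (allFin (length G))) ≤ stabilizerSize G ω
  length-stabiliser ω = length-≤-injection (lookup G) {ys = filter (λ g → g ⟨$⟩ʳ ω ≟ ω) G} (Unique.filter⁺ fixes? (Unique.allFin⁺ _))
    (λ _ _ eq → faithful λ α → cong (_⟨$⟩ʳ α) eq)
    (λ {i} i∈ → ∈-filter⁺ (λ g → g ⟨$⟩ʳ ω ≟ ω) {xs = G} (∈-lookup i) (proj₂ (∈-filter⁻ fixes? {xs = allFin _} i∈)))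
    where fixes? = λ i → act i ω ≟ ω

intersect⇒agree : ∀ {n} (x y : Permutation′ n) → Intersect x y → ∃ λ α → x ⟨$⟩ʳ α ≡ y ⟨$⟩ʳ α
intersect⇒agree x y (α , eq) = α , trans (sym (Perm.inverseʳ y)) (cong (y ⟨$⟩ʳ_) eq)

theorem1p6 : ∀ (p k n : ℕ) → Prime p → n ≡ p ^ k →
    (G : List (Permutation′ n)) → IsPermGroup G → IsTransitive G →
    (S : List (Permutation′ n)) → IsIntersectingSet G S →
    (ω : Fin n) → length S ≤ stabilizerSize G ω
theorem1p6 p k n p-prime n≡pᵏ G isPermGroup isTransitive S isIntersecting ω
  with PermGroup.positions isPermGroup (IsIntersectingSet.distinct isIntersecting) (IsIntersectingSet.subset isIntersecting)
... | is , uniq , len , is⇒ = ≤-trans (≤-reflexive len) (≤-trans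
  (Action.intersecting-bound isGroup act act-unit act-mul (transitive isTransitive) ω p-prime k n≡pᵏ uniq
    λ i∈ j∈ → let x , x∈ , i≗x = is⇒ i∈
                  y , y∈ , j≗y = is⇒ j∈
                  α , agree = intersect⇒agree x y (intersect x∈ y∈)
              in α , trans (i≗x α) (trans agree (sym (j≗y α))))
  (length-stabiliser ω))
  where
  open PermGroup isPermGroup
  open IsIntersectingSet isIntersecting using (intersect)
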